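{- Let $\mathbb Z_n$ denote the cyclic group of order $n$, let $\mathbb Z_2^3=\mathbb Z_2\times\mathbb Z_2\times\mathbb Z_2$, and let $Q_8=\langle a,b : a^4=1,\ b^2=a^2,\ ab=ba^{ -1}\rangle$ be the quaternion group of order $8$. Then $$\mathcal S(\mathbb Z_4\times\mathbb Z_2)=\{8m+1 : m\in\mathbb Z\}\cup\{2^8m : m\in\mathbb Z\},$$ $$\mathcal S(Q_8)=\mathcal S(\mathbb Z_4\times\mathbb Z_2)\cup\{(8m-3)p^2 : m\in\mathbb Z,\ p\equiv 3 \pmod 4 \text{ prime}\},$$ and $$\mathcal S(\mathbb Z_2^3)=\{8m+1 : m\in\mathbb Z\}\cup\{2^8(4m+1): m\in\mathbb Z\}\cup\{2^{12}m : m\in\mathbb Z\}.$$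
   Context: For a finite group $G=\{g_1,\dots,g_n\}$, assign an independent variable $x_g$ to each $g\in G$; the group determinant $\mathscr D_G(x_{g_1},\dots,x_{g_n})$ is the determinant of the $n\times n$ matrix whose $(i,j)$ entry is $x_{g_ig_j^{ -1}}$. Define $\mathcal S(G)=\{\mathscr D_G(x_{g_1},\dots,x_{g_n}) : x_{g_1},\dots,x_{g_n}\in\mathbb Z\}$, the set of integer values of the group determinant at integer arguments. -}

module Defs where

open import Data.Nat as ℕ using (ℕ; zero; suc)
open import Data.Nat.DivMod using (_mod_; _/_)
open import Data.Fin using (Fin; zero; suc; toℕ; punchIn)
open import Data.Integer using (ℤ; +_; -_; _+_; _*_)
open import Data.Product using (_×_; _,_; ∃)
open import Relation.Binary.PropositionalEquality using (_≡_)

sumFin : (n : ℕ) → (Fin n → ℤ) → ℤ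
sumFin zero    f = + 0
sumFin (suc n) f = f zero + sumFin n (λ i → f (suc i))

sign : ℕ → ℤ
sign zero          = + 1
sign (suc zero)    = - (+ 1)
sign (suc (suc k)) = sign k

det : (n : ℕ) → (Fin n → Fin n → ℤ) → ℤ
det zero    M = + 1
det (suc n) M =
  sumFin (suc n) (λ j → sign (toℕ j) * (M zero j * det n (λ r c → M (suc r) (punchIn j c))))

record FinGroup : Set₁ where
  field
    Carrier : Set
    _·_     : Carrier → Carrier → Carrier
    inv     : Carrier → Carrier
    order   : ℕ
    enum    : Fin order → Carrier
    index   : Carrier → Fin order
    enum-index : ∀ g → enum (index g) ≡ g
    index-enum : ∀ i → index (enum i) ≡ i

groupDet : (G : FinGroup) → (FinGroup.Carrier G → ℤ) → ℤ
groupDet G x = det order (λ i j → x (enum i · inv (enum j)))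
  where open FinGroup G

𝒮 : FinGroup → ℤ → Set
𝒮 G z = ∃ λ (x : FinGroup.Carrier G → ℤ) → groupDet G x ≡ z

add4 : Fin 4 → Fin 4 → Fin 4
add4 i k = (toℕ i ℕ.+ toℕ k) mod 4

neg4 : Fin 4 → Fin 4
neg4 i = (4 ℕ.∸ toℕ i) mod 4

add2 : Fin 2 → Fin 2 → Fin 2
add2 i k = (toℕ i ℕ.+ toℕ k) mod 2

idx42 : Fin 4 × Fin 2 → Fin 8
idx42 (zero , zero) = zero
idx42 (suc zero , zero) = suc zero
idx42 (suc (suc zero) , zero) = suc (suc zero)
idx42 (suc (suc (suc zero)) , zero) = suc (suc (suc zero))
idx42 (zero , suc zero) = suc (suc (suc (suc zero)))
idx42 (suc zero , suc zero) = suc (suc (suc (suc (suc zero))))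
idx42 (suc (suc zero) , suc zero) = suc (suc (suc (suc (suc (suc zero)))))
idx42 (suc (suc (suc zero)) , suc zero) = suc (suc (suc (suc (suc (suc (suc zero))))))

enum42 : Fin 8 → Fin 4 × Fin 2
enum42 i = (toℕ i mod 4 , (toℕ i / 4) mod 2)

enum42-idx : ∀ g → enum42 (idx42 g) ≡ g
enum42-idx (zero , zero) = _≡_.refl
enum42-idx (suc zero , zero) = _≡_.refl
enum42-idx (suc (suc zero) , zero) = _≡_.refl
enum42-idx (suc (suc (suc zero)) , zero) = _≡_.refl
enum42-idx (zero , suc zero) = _≡_.refl
enum42-idx (suc zero , suc zero) = _≡_.refl
enum42-idx (suc (suc zero) , suc zero) = _≡_.refl
enum42-idx (suc (suc (suc zero)) , suc zero) = _≡_.refl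

idx-enum42 : ∀ i → idx42 (enum42 i) ≡ i
idx-enum42 zero = _≡_.refl
idx-enum42 (suc zero) = _≡_.refl
idx-enum42 (suc (suc zero)) = _≡_.refl
idx-enum42 (suc (suc (suc zero))) = _≡_.refl
idx-enum42 (suc (suc (suc (suc zero)))) = _≡_.refl
idx-enum42 (suc (suc (suc (suc (suc zero))))) = _≡_.refl
idx-enum42 (suc (suc (suc (suc (suc (suc zero)))))) = _≡_.refl
idx-enum42 (suc (suc (suc (suc (suc (suc (suc zero))))))) = _≡_.refl

Z4×Z2 : FinGroup
Z4×Z2 = record
  { Carrier = Fin 4 × Fin 2
  ; _·_ = λ { (i , j) (k , l) → (add4 i k , add2 j l) }
  ; inv = λ { (i , j) → (neg4 i , j) }
  ; order = 8
  ; enum = enum42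
  ; index = idx42
  ; enum-index = enum42-idx
  ; index-enum = idx-enum42
  }

-- Q8 = ⟨a, b | a^4 = 1, b^2 = a^2, ab = ba^{-1}⟩ ; the pair (i , j)
-- represents a^i b^j, so that b^j a^k = a^{(-1)^j k} b^j.
q8mul : Fin 4 × Fin 2 → Fin 4 × Fin 2 → Fin 4 × Fin 2
q8mul (i , zero)     (k , l)        = (add4 i k , l)
q8mul (i , suc zero) (k , zero)     = (add4 i (neg4 k) , suc zero)
q8mul (i , suc zero) (k , suc zero) = (add4 (add4 i (neg4 k)) (suc (suc zero)) , zero)

q8inv : Fin 4 × Fin 2 → Fin 4 × Fin 2
q8inv (i , zero)     = (neg4 i , zero)
q8inv (i , suc zero) = (add4 i (suc (suc zero)) , suc zero)

Q8 : FinGroup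
Q8 = record
  { Carrier = Fin 4 × Fin 2
  ; _·_ = q8mul
  ; inv = q8inv
  ; order = 8
  ; enum = enum42
  ; index = idx42
  ; enum-index = enum42-idx
  ; index-enum = idx-enum42
  }

idx222 : Fin 2 × Fin 2 × Fin 2 → Fin 8
idx222 (zero , zero , zero) = zero
idx222 (suc zero , zero , zero) = suc zero
idx222 (zero , suc zero , zero) = suc (suc zero)
idx222 (suc zero , suc zero , zero) = suc (suc (suc zero))
idx222 (zero , zero , suc zero) = suc (suc (suc (suc zero)))
idx222 (suc zero , zero , suc zero) = suc (suc (suc (suc (suc zero))))
idx222 (zero , suc zero , suc zero) = suc (suc (suc (suc (suc (suc zero)))))
idx222 (suc zero , suc zero , suc zero) = suc (suc (suc (suc (suc (suc (suc zero))))))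

enum222 : Fin 8 → Fin 2 × Fin 2 × Fin 2
enum222 i = (toℕ i mod 2 , (toℕ i / 2) mod 2 , (toℕ i / 4) mod 2)

enum222-idx : ∀ g → enum222 (idx222 g) ≡ g
enum222-idx (zero , zero , zero) = _≡_.refl
enum222-idx (suc zero , zero , zero) = _≡_.refl
enum222-idx (zero , suc zero , zero) = _≡_.refl
enum222-idx (suc zero , suc zero , zero) = _≡_.refl
enum222-idx (zero , zero , suc zero) = _≡_.refl
enum222-idx (suc zero , zero , suc zero) = _≡_.refl
enum222-idx (zero , suc zero , suc zero) = _≡_.refl
enum222-idx (suc zero , suc zero , suc zero) = _≡_.refl

idx-enum222 : ∀ i → idx222 (enum222 i) ≡ i
idx-enum222 (zero) = _≡_.refl
idx-enum222 (suc zero) = _≡_.refl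
idx-enum222 (suc (suc zero)) = _≡_.refl
idx-enum222 (suc (suc (suc zero))) = _≡_.refl
idx-enum222 (suc (suc (suc (suc zero)))) = _≡_.refl
idx-enum222 (suc (suc (suc (suc (suc zero))))) = _≡_.refl
idx-enum222 (suc (suc (suc (suc (suc (suc zero)))))) = _≡_.refl
idx-enum222 (suc (suc (suc (suc (suc (suc (suc zero))))))) = _≡_.refl

Z2³ : FinGroup
Z2³ = record
  { Carrier = Fin 2 × Fin 2 × Fin 2
  ; _·_ = λ { (a , b , c) (a′ , b′ , c′) → (add2 a a′ , add2 b b′ , add2 c c′) }
  ; inv = λ g → g
  ; order = 8
  ; enum = enum222
  ; index = idx222
  ; enum-index = enum222-idx
  ; index-enum = idx-enum222
  }

{-# OPTIONS --safe #-}
module Submission where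

-- Each group determinant factors over ℤ.  For ℤ₄ × ℤ₂ and ℤ₂³ it is the product of the
-- determinants of the index-two subgroup at the sums and at the differences of the two halves of
-- the argument; these arguments agree modulo 2, which makes odd values squares modulo 8 and controls the
-- power of 2 in even ones.  For Q₈ it is L N², with L a ℤ₂ × ℤ₂ determinant and N a sum of four
-- squares congruent to the arguments of L modulo 2.  An odd L N² is 1 modulo 8 unless three of the
-- arguments are odd; then L is -3 modulo 8 and N is 3 modulo 4, so N has a prime factor p that is
-- 3 modulo 4.  Conversely such a p is a sum of four squares, necessarily with three odd entries,
-- which gives N = p and any L ≡ -3.  The remaining values come from explicit families.

-- The obstacle is the factorisation itself: cofactor expansion of an 8 × 8 matrix produces 8!
-- signed products. It is settled by computation, expanding the determinant over a verified
-- polynomial arithmetic and comparing coefficients with the factored form by `refl`. Every matrix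
-- entry is a single variable, so the expansion needs only addition, negation and multiplication by
-- a variable; general products occur only in the factored form. One prime is enough in the
-- exceptional family because the rest of N is odd: its square is 1 modulo 8 and disappears into the
-- class of L. In the other direction the four-square theorem is therefore wanted only at primes,
-- where Lagrange's descent applies directly and no multiplicativity over composite numbers enters.

open import Defs
open import Data.Bool using (Bool; true; false; _∧_)
open import Data.Empty using (⊥; ⊥-elim)
open import Data.Fin as Fin using (Fin; zero; suc; toℕ; fromℕ<; opposite; splitAt; punchIn; #_)
open import Data.Fin.Properties
  using (pigeonhole; toℕ≤pred[n]; toℕ-fromℕ<; toℕ-injective; opposite-prop; opposite-involutive;
         splitAt⁻¹-↑ˡ; splitAt⁻¹-↑ʳ)
open import Data.Integer as ℤ using (ℤ; +_; -[1+_]; -_; _+_; _-_; _*_; ∣_∣)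
open import Data.Integer.DivMod using (_%ℕ_; _/ℕ_; n%ℕd<d; a≡a%ℕn+[a/ℕn]*n)
open import Data.Integer.Properties
  using (+-identityˡ; *-identityˡ; *-zeroʳ; i-j≡0⇒i≡j; *-cancelˡ-≡; pos-+; pos-*; abs-*; ∣i∣≡0⇒i≡0;
         ∣-i∣≡∣i∣; +∣i∣≡i⊎+∣i∣≡-i; +-injective; +-comm; +-assoc)
open import Data.Integer.Tactic.RingSolver using (solve-∀)
open import Data.List using (List; []; _∷_)
open import Data.List.Relation.Unary.All using (All; []; _∷_)
open import Data.Nat as ℕ
  using (ℕ; zero; suc; NonZero; _≤_; _<_; _∸_; _%_; _/_; s≤s; z≤n)
open import Data.Nat.Divisibility using (_∣_; divides; ∣⇒≤; ∣m+n∣m⇒∣n; _∣?_)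
open import Data.Nat.DivMod using (m%n<n; m≡m%n+[m/n]*n; %-distribˡ-*)
open import Data.Nat.Induction using (<-wellFounded)
open import Data.Nat.ListAction using (product)
open import Data.Nat.Primality using (Prime; prime⇒irreducible; euclidsLemma)
open import Data.Nat.Primality.Factorisation using (PrimeFactorisation; factorise)
import Data.Nat.Properties as ℕ
open import Data.Nat.Tactic.RingSolver using () renaming (solve-∀ to solve-ℕ)
open import Data.Product using (_×_; ∃; Σ; _,_; proj₁; proj₂)
open import Data.Sum using (_⊎_; inj₁; inj₂; [_,_]′; map₁; reduce)
open import Data.Vec using (Vec; []; _∷_; lookup; tabulate)
open import Data.Vec.N-ary using (N-ary; _$ⁿ_; curryⁿ; ∀ⁿ)
open import Data.Vec.Properties using (lookup∘tabulate; tabulate∘lookup; tabulate-cong)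
open import Function using (_∘_)
open import Function.Bundles using (_⇔_; mk⇔)
open import Induction.WellFounded using (Acc; acc)
open import Relation.Binary.Definitions using (tri<; tri≈; tri>)
open import Relation.Binary.PropositionalEquality hiding ([_])
open import Relation.Nullary using (yes; no)
open import Relation.Nullary.Decidable using (False; toWitnessFalse)

-- Determinants by polynomial arithmetic

-- Polynomials in Horner form, nested one variable at a time.
Poly : ℕ → Set
Poly zero    = ℤ
Poly (suc n) = List (Poly n)

eval : ∀ {n} → Poly n → Vec ℤ n → ℤ
eval {zero}  a       ρ       = a
eval {suc n} []      ρ       = + 0
eval {suc n} (a ∷ p) (t ∷ ρ) = eval a ρ + t * eval p (t ∷ ρ)

zeroP : ∀ {n} → Poly n
zeroP {zero}  = + 0
zeroP {suc n} = []

conP : ∀ {n} → ℤ → Poly n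
conP {zero}  c = c
conP {suc n} c = conP c ∷ []

mulVar : ∀ {n} → Fin n → Poly n → Poly n
mulVar zero    p       = zeroP ∷ p
mulVar (suc i) []      = []
mulVar (suc i) (a ∷ p) = mulVar i a ∷ mulVar (suc i) p

addP : ∀ {n} → Poly n → Poly n → Poly n
addP {zero}  a       b       = a + b
addP {suc n} []      q       = q
addP {suc n} (a ∷ p) []      = a ∷ p
addP {suc n} (a ∷ p) (b ∷ q) = addP a b ∷ addP p q

negP : ∀ {n} → Poly n → Poly n
negP {zero}  a       = - a
negP {suc n} []      = []
negP {suc n} (a ∷ p) = negP a ∷ negP p

mulP   : ∀ {n} → Poly n → Poly n → Poly n
scaleP : ∀ {n} → Poly n → Poly (suc n) → Poly (suc n)
mulP {zero}  a       b = a * b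
mulP {suc n} []      q = []
mulP {suc n} (a ∷ p) q = addP (scaleP a q) (zeroP ∷ mulP p q)
scaleP a []      = []
scaleP a (b ∷ q) = mulP a b ∷ scaleP a q

-- Coefficient lists are never trimmed, so the zero polynomial has many representations. Equality is
-- therefore tested by subtracting and checking that every coefficient vanishes, not by comparing
-- normal forms.
isZero : ∀ {n} → Poly n → Bool
isZero {zero}  (+ 0)   = true
isZero {zero}  _       = false
isZero {suc n} []      = true
isZero {suc n} (a ∷ p) = isZero a ∧ isZero p

eval-zeroP : ∀ {n} (ρ : Vec ℤ n) → eval {n} zeroP ρ ≡ + 0
eval-zeroP {zero}  ρ = refl
eval-zeroP {suc n} ρ = refl

eval-conP : ∀ {n} c (ρ : Vec ℤ n) → eval {n} (conP c) ρ ≡ c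
eval-conP {zero}  c ρ = refl
eval-conP {suc n} c (t ∷ ρ) rewrite eval-conP c ρ = lemma c t
  where lemma : ∀ c t → c + t * + 0 ≡ c
        lemma = solve-∀

eval-mulVar : ∀ {n} i p (ρ : Vec ℤ n) → eval (mulVar i p) ρ ≡ lookup ρ i * eval p ρ
eval-mulVar {suc n} zero p (t ∷ ρ) rewrite eval-zeroP ρ = +-identityˡ _
eval-mulVar (suc i) [] (t ∷ ρ) = sym (*-zeroʳ (lookup ρ i))
eval-mulVar (suc i) (a ∷ p) (t ∷ ρ)
  rewrite eval-mulVar i a ρ | eval-mulVar (suc i) p (t ∷ ρ) =
  lemma (lookup ρ i) (eval a ρ) t (eval p (t ∷ ρ))
  where lemma : ∀ x a t p → x * a + t * (x * p) ≡ x * (a + t * p)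
        lemma = solve-∀

eval-addP : ∀ {n} p q (ρ : Vec ℤ n) → eval (addP p q) ρ ≡ eval p ρ + eval q ρ
eval-addP {zero}  a b ρ = refl
eval-addP {suc n} [] q ρ = sym (+-identityˡ _)
eval-addP {suc n} (a ∷ p) [] (t ∷ ρ) = lemma (eval (a ∷ p) (t ∷ ρ))
  where lemma : ∀ c → c ≡ c + + 0
        lemma = solve-∀
eval-addP {suc n} (a ∷ p) (b ∷ q) (t ∷ ρ)
  rewrite eval-addP a b ρ | eval-addP p q (t ∷ ρ) =
  lemma (eval a ρ) (eval b ρ) t (eval p (t ∷ ρ)) (eval q (t ∷ ρ))
  where lemma : ∀ a b t p q → a + b + t * (p + q) ≡ a + t * p + (b + t * q)
        lemma = solve-∀

eval-negP : ∀ {n} p (ρ : Vec ℤ n) → eval (negP p) ρ ≡ - eval p ρ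
eval-negP {zero}  a ρ = refl
eval-negP {suc n} [] ρ = refl
eval-negP {suc n} (a ∷ p) (t ∷ ρ) rewrite eval-negP a ρ | eval-negP p (t ∷ ρ) =
  lemma (eval a ρ) t (eval p (t ∷ ρ))
  where lemma : ∀ a t p → - a + t * - p ≡ - (a + t * p)
        lemma = solve-∀

eval-mulP   : ∀ {n} p q (ρ : Vec ℤ n) → eval (mulP p q) ρ ≡ eval p ρ * eval q ρ
eval-scaleP : ∀ {n} a q t (ρ : Vec ℤ n) →
  eval (scaleP a q) (t ∷ ρ) ≡ eval a ρ * eval q (t ∷ ρ)
eval-mulP {zero}  a b ρ = refl
eval-mulP {suc n} [] q ρ = refl
eval-mulP {suc n} (a ∷ p) q (t ∷ ρ)
  rewrite eval-addP (scaleP a q) (zeroP ∷ mulP p q) (t ∷ ρ)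
        | eval-scaleP a q t ρ | eval-zeroP ρ | eval-mulP p q (t ∷ ρ) =
  lemma (eval a ρ) (eval q (t ∷ ρ)) t (eval p (t ∷ ρ))
  where lemma : ∀ a q t p → a * q + (+ 0 + t * (p * q)) ≡ (a + t * p) * q
        lemma = solve-∀
eval-scaleP a [] t ρ = sym (*-zeroʳ (eval a ρ))
eval-scaleP a (b ∷ q) t ρ rewrite eval-mulP a b ρ | eval-scaleP a q t ρ =
  lemma (eval a ρ) (eval b ρ) t (eval q (t ∷ ρ))
  where lemma : ∀ a b t q → a * b + t * (a * q) ≡ a * (b + t * q)
        lemma = solve-∀

isZero-sound : ∀ {n} p (ρ : Vec ℤ n) → isZero p ≡ true → eval p ρ ≡ + 0
isZero-sound {zero}  (+ 0)   ρ       _  = refl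
isZero-sound {suc n} []      ρ       _  = refl
isZero-sound {suc n} (a ∷ p) (t ∷ ρ) eq with isZero a in a≡0
... | true rewrite isZero-sound a ρ a≡0 | isZero-sound p (t ∷ ρ) eq = lemma t
  where lemma : ∀ t → + 0 + t * + 0 ≡ + 0
        lemma = solve-∀

-- Reflected expressions and the identity checker

infixl 6 _:+_ _:-_
infixl 7 _:*_
data Expr (n : ℕ) : Set where
  var            : Fin n → Expr n
  con            : ℤ → Expr n
  _:+_ _:-_ _:*_ : Expr n → Expr n → Expr n

⟦_⟧ : ∀ {n} → Expr n → Vec ℤ n → ℤ
⟦ var i ⟧ ρ  = lookup ρ i
⟦ con c ⟧ ρ  = c
⟦ a :+ b ⟧ ρ = ⟦ a ⟧ ρ + ⟦ b ⟧ ρ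
⟦ a :- b ⟧ ρ = ⟦ a ⟧ ρ - ⟦ b ⟧ ρ
⟦ a :* b ⟧ ρ = ⟦ a ⟧ ρ * ⟦ b ⟧ ρ

norm : ∀ {n} → Expr n → Poly n
norm (var i)  = mulVar i (conP (+ 1))
norm (con c)  = conP c
norm (a :+ b) = addP (norm a) (norm b)
norm (a :- b) = addP (norm a) (negP (norm b))
norm (a :* b) = mulP (norm a) (norm b)

eval-norm : ∀ {n} e (ρ : Vec ℤ n) → eval (norm e) ρ ≡ ⟦ e ⟧ ρ
eval-norm (var i) ρ rewrite eval-mulVar i (conP (+ 1)) ρ | eval-conP (+ 1) ρ = lemma (lookup ρ i)
  where lemma : ∀ t → t * + 1 ≡ t
        lemma = solve-∀
eval-norm (con c) ρ = eval-conP c ρ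
eval-norm (a :+ b) ρ
  rewrite eval-addP (norm a) (norm b) ρ | eval-norm a ρ | eval-norm b ρ = refl
eval-norm (a :- b) ρ
  rewrite eval-addP (norm a) (negP (norm b)) ρ | eval-negP (norm b) ρ
        | eval-norm a ρ | eval-norm b ρ = refl
eval-norm (a :* b) ρ
  rewrite eval-mulP (norm a) (norm b) ρ | eval-norm a ρ | eval-norm b ρ = refl

-- Only the right-hand side has to be an expression. This lets `p` be the cofactor expansion, which
-- is built directly as a polynomial.
eval≡⟦⟧ : ∀ {n} p e (ρ : Vec ℤ n) →
  isZero (addP p (negP (norm e))) ≡ true → eval p ρ ≡ ⟦ e ⟧ ρ
eval≡⟦⟧ p e ρ eq = i-j≡0⇒i≡j _ _ (begin
  eval p ρ - ⟦ e ⟧ ρ                   ≡⟨ cong (λ v → eval p ρ - v) (eval-norm e ρ) ⟨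
  eval p ρ - eval (norm e) ρ           ≡⟨ cong (_+_ (eval p ρ)) (eval-negP (norm e) ρ) ⟨
  eval p ρ + eval (negP (norm e)) ρ    ≡⟨ eval-addP p (negP (norm e)) ρ ⟨
  eval (addP p (negP (norm e))) ρ      ≡⟨ isZero-sound _ ρ eq ⟩
  + 0                                  ∎)
  where open ≡-Reasoning

infix 4 _:=_
_:=_ : ∀ {n} → Expr n → Expr n → Expr n × Expr n
_:=_ = _,_

-- Unlike solve-∀, this solver sees through ℤ-valued functions that have an Expr-valued copy.
solve : ∀ n (f : N-ary n (Expr n) (Expr n × Expr n)) →
  let lhs = proj₁ (f $ⁿ tabulate var) ; rhs = proj₂ (f $ⁿ tabulate var) in
  isZero (addP (norm lhs) (negP (norm rhs))) ≡ true →
  ∀ⁿ n (curryⁿ {n = n} λ ρ → ⟦ lhs ⟧ ρ ≡ ⟦ rhs ⟧ ρ)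
solve n f eq = all n λ ρ → trans (sym (eval-norm lhs ρ)) (eval≡⟦⟧ (norm lhs) rhs ρ eq)
  where
  lhs rhs : Expr n
  lhs = proj₁ (f $ⁿ tabulate var)
  rhs = proj₂ (f $ⁿ tabulate var)
  all : ∀ n {P : Vec ℤ n → Set} → (∀ ρ → P ρ) → ∀ⁿ n (curryⁿ {n = n} P)
  all zero    h = h []
  all (suc n) h = λ t → all n (λ ρ → h (t ∷ ρ))

-- Cofactor expansion over polynomials

sumP : ∀ {k} n → (Fin n → Poly k) → Poly k
sumP zero    f = zeroP
sumP (suc n) f = addP (f zero) (sumP n (f ∘ suc))

signP : ∀ {k} → ℕ → Poly k → Poly k
signP zero          p = p
signP (suc zero)    p = negP p
signP (suc (suc k)) p = signP k p

-- M i j is the index of the variable in entry (i , j).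
detP : ∀ {k} n → (Fin n → Fin n → Fin k) → Poly k
detP zero    M = conP (+ 1)
detP (suc n) M =
  sumP (suc n) (λ j → signP (toℕ j) (mulVar (M zero j) (detP n (λ r c → M (suc r) (punchIn j c)))))

sumFin-cong : ∀ n {f g : Fin n → ℤ} → (∀ i → f i ≡ g i) → sumFin n f ≡ sumFin n g
sumFin-cong zero    f≗g = refl
sumFin-cong (suc n) f≗g = cong₂ _+_ (f≗g zero) (sumFin-cong n (f≗g ∘ suc))

det-cong : ∀ n {M N : Fin n → Fin n → ℤ} → (∀ i j → M i j ≡ N i j) → det n M ≡ det n N
det-cong zero    M≗N = refl
det-cong (suc n) M≗N = sumFin-cong (suc n) λ j →
  cong (sign (toℕ j) *_) (cong₂ _*_ (M≗N zero j) (det-cong n λ r c → M≗N (suc r) (punchIn j c)))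

eval-sumP : ∀ {k} n (f : Fin n → Poly k) ρ → eval (sumP n f) ρ ≡ sumFin n (λ i → eval (f i) ρ)
eval-sumP zero    f ρ = eval-zeroP ρ
eval-sumP (suc n) f ρ =
  trans (eval-addP (f zero) (sumP n (f ∘ suc)) ρ) (cong (_+_ (eval (f zero) ρ)) (eval-sumP n (f ∘ suc) ρ))

eval-signP : ∀ {n} k p (ρ : Vec ℤ n) → eval (signP k p) ρ ≡ sign k * eval p ρ
eval-signP zero p ρ = sym (*-identityˡ _)
eval-signP (suc zero) p ρ = trans (eval-negP p ρ) (lemma (eval p ρ))
  where lemma : ∀ a → - a ≡ (- (+ 1)) * a
        lemma = solve-∀
eval-signP (suc (suc k)) p ρ = eval-signP k p ρ

eval-detP : ∀ {k} n (M : Fin n → Fin n → Fin k) ρ →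
  eval (detP n M) ρ ≡ det n (λ i j → lookup ρ (M i j))
eval-detP zero    M ρ = eval-conP (+ 1) ρ
eval-detP (suc n) M ρ = trans (eval-sumP (suc n) summand ρ) (sumFin-cong (suc n) λ j →
  trans (eval-signP (toℕ j) (mulVar (M zero j) (detP n (minor j))) ρ) (cong (sign (toℕ j) *_)
    (trans (eval-mulVar (M zero j) (detP n (minor j)) ρ)
           (cong (lookup ρ (M zero j) *_) (eval-detP n (minor j) ρ)))))
  where
  minor : Fin (suc n) → Fin n → Fin n → Fin _
  minor j r c = M (suc r) (punchIn j c)
  summand : Fin (suc n) → Poly _
  summand j = signP (toℕ j) (mulVar (M zero j) (detP n (minor j)))

module _ (G : FinGroup) where
  open FinGroup G

  groupDetP : Poly order
  groupDetP = detP order (λ i j → index (enum i · inv (enum j)))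

  -- A record rather than a synonym, so that comparing two such types does not recompute
  -- the determinant.
  record HasDet (e : Expr order) : Set where
    constructor has-det
    field difference≡0 : isZero (addP groupDetP (negP (norm e))) ≡ true

  groupDet≡⟦⟧ : ∀ e → HasDet e → ∀ x → groupDet G x ≡ ⟦ e ⟧ (tabulate (x ∘ enum))
  groupDet≡⟦⟧ e (has-det eq) x = begin
    groupDet G x                             ≡⟨ det-cong order (λ i j → entry (enum i · inv (enum j))) ⟨
    det order (λ i j → lookup (tabulate (x ∘ enum)) (index (enum i · inv (enum j))))
                                             ≡⟨ eval-detP order _ (tabulate (x ∘ enum)) ⟨
    eval groupDetP (tabulate (x ∘ enum))     ≡⟨ eval≡⟦⟧ groupDetP e _ eq ⟩
    ⟦ e ⟧ (tabulate (x ∘ enum))              ∎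
    where
    open ≡-Reasoning
    entry : ∀ g → lookup (tabulate (x ∘ enum)) (index g) ≡ x g
    entry g = trans (lookup∘tabulate (x ∘ enum) (index g)) (cong x (enum-index g))

  𝒮-elim : ∀ {e} → HasDet e → (P : ℤ → Set) → (∀ ρ → P (⟦ e ⟧ ρ)) → ∀ {z} → 𝒮 G z → P z
  𝒮-elim {e} h P values (x , det≡z) =
    subst P (trans (sym (groupDet≡⟦⟧ e h x)) det≡z) (values (tabulate (x ∘ enum)))

  𝒮-intro : ∀ {e} → HasDet e → ∀ ρ {z} → ⟦ e ⟧ ρ ≡ z → 𝒮 G z
  𝒮-intro {e} h ρ eq = lookup ρ ∘ index , trans (groupDet≡⟦⟧ e h (lookup ρ ∘ index)) (trans (cong ⟦ e ⟧
    (trans (tabulate-cong (λ i → cong (lookup ρ) (index-enum i))) (tabulate∘lookup ρ))) eq)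

-- Congruences satisfied by the factors

infix 4 _≈_[mod_]
-- The quotient is data and the equation is solved for `x`, so matching it with `refl` substitutes
-- `x` away and each congruence rule becomes a polynomial identity with an explicit new quotient.
record _≈_[mod_] (x y n : ℤ) : Set where
  constructor _,_
  field
    quotient : ℤ
    equality : x ≡ n * quotient + y

*-cong-mod : ∀ {n x x′ y y′} → x ≈ y [mod n ] → x′ ≈ y′ [mod n ] → x * x′ ≈ y * y′ [mod n ]
*-cong-mod {n} {y = y} {y′} (k , refl) (k′ , refl) = n * k * k′ + k * y′ + y * k′ , lemma n k k′ y y′
  where lemma : ∀ n k k′ y y′ → (n * k + y) * (n * k′ + y′) ≡ n * (n * k * k′ + k * y′ + y * k′) + y * y′
        lemma = solve-∀

≈-trans : ∀ {n x y z} → x ≈ y [mod n ] → y ≈ z [mod n ] → x ≈ z [mod n ]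
≈-trans {n} {z = z} (k , refl) (k′ , refl) = k + k′ , lemma n k k′ z
  where lemma : ∀ n k k′ z → n * k + (n * k′ + z) ≡ n * (k + k′) + z
        lemma = solve-∀

Even Odd : ℤ → Set
Even n = ∃ λ k → n ≡ + 2 * k
Odd  n = n ≈ + 1 [mod + 2 ]

parity : ∀ n → Even n ⊎ Odd n
parity n with n %ℕ 2 | n /ℕ 2 | n%ℕd<d n 2 | a≡a%ℕn+[a/ℕn]*n n 2
... | 0 | q | _ | eq = inj₁ (q , trans eq (lemma q))
  where lemma : ∀ q → + 0 + q * + 2 ≡ + 2 * q
        lemma = solve-∀
... | 1 | q | _ | eq = inj₂ (q , trans eq (lemma q))
  where lemma : ∀ q → + 1 + q * + 2 ≡ + 2 * q + + 1
        lemma = solve-∀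
... | suc (suc _) | _ | s≤s (s≤s ()) | _

odd-square : ∀ {n} → Odd n → n * n ≈ + 1 [mod + 8 ]
odd-square (k , refl) with parity k
... | inj₁ (j , refl) = + 2 * j * j + j , lemma j
  where lemma : ∀ j → (+ 2 * (+ 2 * j) + + 1) * (+ 2 * (+ 2 * j) + + 1) ≡ + 8 * (+ 2 * j * j + j) + + 1
        lemma = solve-∀
... | inj₂ (j , refl) = + 2 * j * j + + 3 * j + + 1 , lemma j
  where lemma : ∀ j → (+ 2 * (+ 2 * j + + 1) + + 1) * (+ 2 * (+ 2 * j + + 1) + + 1)
                ≡ + 8 * (+ 2 * j * j + + 3 * j + + 1) + + 1
        lemma = solve-∀

even-shift : ∀ {n} → Even n → ∀ e → Even (n - + 2 * e)
even-shift (k , refl) e = k - e , lemma k e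
  where lemma : ∀ k e → + 2 * k - + 2 * e ≡ + 2 * (k - e)
        lemma = solve-∀

odd-shift : ∀ {n} → Odd n → ∀ e → Odd (n - + 2 * e)
odd-shift (k , refl) e = k - e , lemma k e
  where lemma : ∀ k e → + 2 * k + + 1 - + 2 * e ≡ + 2 * (k - e) + + 1
        lemma = solve-∀

-- With p = c₀ + c₂, q = c₁ + c₃, a = c₂, b = c₃, these are the group determinants of ℤ₄ and
-- ℤ₂ × ℤ₂ at (c₀ , c₁ , c₂ , c₃).
Δ₄ Δ₂₂ : ℤ → ℤ → ℤ → ℤ → ℤ
Δ₄ p q a b =
  (p * p - q * q) * ((p - + 2 * a) * (p - + 2 * a) + (q - + 2 * b) * (q - + 2 * b))
Δ₂₂ p q a b =
  (p * p - q * q) * ((p - + 2 * a) * (p - + 2 * a) - (q - + 2 * b) * (q - + 2 * b))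

:Δ₄ :Δ₂₂ : ∀ {n} → Expr n → Expr n → Expr n → Expr n → Expr n
:Δ₄ p q a b = (p :* p :- q :* q) :*
  ((p :- con (+ 2) :* a) :* (p :- con (+ 2) :* a) :+ (q :- con (+ 2) :* b) :* (q :- con (+ 2) :* b))
:Δ₂₂ p q a b = (p :* p :- q :* q) :*
  ((p :- con (+ 2) :* a) :* (p :- con (+ 2) :* a) :- (q :- con (+ 2) :* b) :* (q :- con (+ 2) :* b))

Δ₄-swap : ∀ p q a b → Δ₄ p q a b ≡ (- + 1) * Δ₄ q p b a
Δ₄-swap = solve 4 (λ p q a b → :Δ₄ p q a b := con (- + 1) :* :Δ₄ q p b a) refl

-- Exchanging the roles of p and q negates p² - q² and fixes the sum of squares; the two signs
-- cancel in the product. This reduces the case p even, q odd to p odd, q even.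
Δ₄*Δ₄-swap : ∀ p q a b p′ q′ a′ b′ → Δ₄ p q a b * Δ₄ p′ q′ a′ b′ ≡ Δ₄ q p b a * Δ₄ q′ p′ b′ a′
Δ₄*Δ₄-swap p q a b p′ q′ a′ b′ = trans
  (cong₂ _*_ (Δ₄-swap p q a b) (Δ₄-swap p′ q′ a′ b′)) (lemma (Δ₄ q p b a) (Δ₄ q′ p′ b′ a′))
  where lemma : ∀ x y → (- + 1) * x * ((- + 1) * y) ≡ x * y
        lemma = solve-∀

Δ₂₂-swap : ∀ p q a b → Δ₂₂ p q a b ≡ Δ₂₂ q p b a
Δ₂₂-swap = solve 4 (λ p q a b → :Δ₂₂ p q a b := :Δ₂₂ q p b a) refl

Δ₄-even-even : ∀ {p q} → Even p → Even q → ∀ a b → ∃ λ w → Δ₄ p q a b ≡ + 16 * w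
Δ₄-even-even (p , refl) (q , refl) a b = (p * p - q * q) * ((p - a) * (p - a) + (q - b) * (q - b)) , lemma p q a b
  where
  lemma : ∀ p q a b → Δ₄ (+ 2 * p) (+ 2 * q) a b
          ≡ + 16 * ((p * p - q * q) * ((p - a) * (p - a) + (q - b) * (q - b)))
  lemma = solve 4 (λ p q a b → :Δ₄ (con (+ 2) :* p) (con (+ 2) :* q) a b
    := con (+ 16) :* ((p :* p :- q :* q) :* ((p :- a) :* (p :- a) :+ (q :- b) :* (q :- b)))) refl

-- Odd squares are 1 modulo 8, so the difference contributes 8 and the sum contributes 2. In `Δ₂₂`
-- both factors are differences, whence 64.
Δ₄-odd-odd : ∀ {p q} → Odd p → Odd q → ∀ a b → ∃ λ w → Δ₄ p q a b ≡ + 16 * w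
Δ₄-odd-odd op oq a b
  with odd-square op | odd-square oq | odd-square (odd-shift op a) | odd-square (odd-shift oq b)
... | s , p² | s′ , q² | t , u² | t′ , v² =
  (s - s′) * (+ 4 * t + + 4 * t′ + + 1) , trans (cong₂ _*_ (cong₂ _-_ p² q²) (cong₂ _+_ u² v²)) (lemma s s′ t t′)
  where
  lemma : ∀ s s′ t t′ → (+ 8 * s + + 1 - (+ 8 * s′ + + 1)) * (+ 8 * t + + 1 + (+ 8 * t′ + + 1))
          ≡ + 16 * ((s - s′) * (+ 4 * t + + 4 * t′ + + 1))
  lemma = solve-∀

Δ₂₂-odd-odd : ∀ {p q} → Odd p → Odd q → ∀ a b → ∃ λ w → Δ₂₂ p q a b ≡ + 64 * w
Δ₂₂-odd-odd op oq a b
  with odd-square op | odd-square oq | odd-square (odd-shift op a) | odd-square (odd-shift oq b)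
... | s , p² | s′ , q² | t , u² | t′ , v² =
  (s - s′) * (t - t′) , trans (cong₂ _*_ (cong₂ _-_ p² q²) (cong₂ _-_ u² v²)) (lemma s s′ t t′)
  where
  lemma : ∀ s s′ t t′ → (+ 8 * s + + 1 - (+ 8 * s′ + + 1)) * (+ 8 * t + + 1 - (+ 8 * t′ + + 1))
          ≡ + 64 * ((s - s′) * (t - t′))
  lemma = solve-∀

-- With q replaced by 2q and the odd squares by 1, the product is (1 - 4q²)(1 + 4(q - b)²), and
-- modulo 8 its q-terms cancel. `Δ₂₂` has a minus sign in the second factor, but 4 and -4 agree
-- modulo 8, so the class is the same.
Δ₄-odd-even : ∀ {p q} → Odd p → Even q → ∀ a b → Δ₄ p q a b ≈ + 4 * (b * b) + + 1 [mod + 8 ]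
Δ₄-odd-even op (q , refl) a b
  with odd-square op | odd-square (odd-shift op a)
... | s , p² | t , u² =
  t * (+ 1 + + 8 * s - + 4 * q * q) + s * (+ 1 + + 4 * (q - b) * (q - b))
    - q * b - + 2 * q * q * (q - b) * (q - b) ,
  trans
  (cong₂ (λ x y → (x - + 2 * q * (+ 2 * q)) * (y + (+ 2 * q - + 2 * b) * (+ 2 * q - + 2 * b))) p² u²)
  (lemma q b s t)
  where
  lemma : ∀ q b s t →
    (+ 8 * s + + 1 - + 2 * q * (+ 2 * q)) * (+ 8 * t + + 1 + (+ 2 * q - + 2 * b) * (+ 2 * q - + 2 * b))
    ≡ + 8 * (t * (+ 1 + + 8 * s - + 4 * q * q) + s * (+ 1 + + 4 * (q - b) * (q - b))
             - q * b - + 2 * q * q * (q - b) * (q - b))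
      + (+ 4 * (b * b) + + 1)
  lemma = solve-∀

Δ₂₂-odd-even : ∀ {p q} → Odd p → Even q → ∀ a b → Δ₂₂ p q a b ≈ + 4 * (b * b) + + 1 [mod + 8 ]
Δ₂₂-odd-even op (q , refl) a b
  with odd-square op | odd-square (odd-shift op a)
... | s , p² | t , u² =
  t * (+ 1 + + 8 * s - + 4 * q * q) + s * (+ 1 - + 4 * (q - b) * (q - b))
    - q * q + q * b - b * b + + 2 * q * q * (q - b) * (q - b) ,
  trans
  (cong₂ (λ x y → (x - + 2 * q * (+ 2 * q)) * (y - (+ 2 * q - + 2 * b) * (+ 2 * q - + 2 * b))) p² u²)
  (lemma q b s t)
  where
  lemma : ∀ q b s t →
    (+ 8 * s + + 1 - + 2 * q * (+ 2 * q)) * (+ 8 * t + + 1 - (+ 2 * q - + 2 * b) * (+ 2 * q - + 2 * b))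
    ≡ + 8 * (t * (+ 1 + + 8 * s - + 4 * q * q) + s * (+ 1 - + 4 * (q - b) * (q - b))
             - q * q + q * b - b * b + + 2 * q * q * (q - b) * (q - b))
      + (+ 4 * (b * b) + + 1)
  lemma = solve-∀

-- `b` and `b - 2h` have one parity, so both factors lie in the same class, 1 or 5, and either
-- squares to 1.
product≈1 : ∀ b h → (+ 4 * (b * b) + + 1) * (+ 4 * ((b - + 2 * h) * (b - + 2 * h)) + + 1) ≈ + 1 [mod + 8 ]
product≈1 b h = b * b - + 2 * b * h + + 2 * h * h + + 2 * b * b * (b - + 2 * h) * (b - + 2 * h) , lemma b h
  where
  lemma : ∀ b h → (+ 4 * (b * b) + + 1) * (+ 4 * ((b - + 2 * h) * (b - + 2 * h)) + + 1)
    ≡ + 8 * (b * b - + 2 * b * h + + 2 * h * h + + 2 * b * b * (b - + 2 * h) * (b - + 2 * h)) + + 1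
  lemma = solve-∀

*-multiples : ∀ {x y} c d → (∃ λ w → x ≡ c * w) → (∃ λ w → y ≡ d * w) → ∃ λ m → x * y ≡ c * d * m
*-multiples c d (w , eq) (w′ , eq′) = w * w′ , trans (cong₂ _*_ eq eq′) (lemma c d w w′)
  where lemma : ∀ c d w w′ → c * w * (d * w′) ≡ c * d * (w * w′)
        lemma = solve-∀

-- The differences of the two halves are written as the sums minus even shifts, so a single split on
-- the parities of `p` and `q` decides both factors.
Z4×Z2-residues : ∀ p q a b e f g h →
  let z = Δ₄ p q a b * Δ₄ (p - + 2 * e) (q - + 2 * f) (a - + 2 * g) (b - + 2 * h) in
  z ≈ + 1 [mod + 8 ] ⊎ (∃ λ m → z ≡ + 256 * m)
Z4×Z2-residues p q a b e f g h with parity p | parity q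
... | inj₁ ep | inj₁ eq =
  inj₂ (*-multiples (+ 16) (+ 16) (Δ₄-even-even ep eq a b) (Δ₄-even-even (even-shift ep e) (even-shift eq f) _ _))
... | inj₂ op | inj₂ oq =
  inj₂ (*-multiples (+ 16) (+ 16) (Δ₄-odd-odd op oq a b) (Δ₄-odd-odd (odd-shift op e) (odd-shift oq f) _ _))
... | inj₂ op | inj₁ eq =
  inj₁ (≈-trans (*-cong-mod (Δ₄-odd-even op eq a b)
                               (Δ₄-odd-even (odd-shift op e) (even-shift eq f) _ _))
                   (product≈1 b h))
... | inj₁ ep | inj₂ oq =
  inj₁ (subst (λ z → z ≈ + 1 [mod + 8 ])
              (sym (Δ₄*Δ₄-swap p q a b (p - + 2 * e) (q - + 2 * f) (a - + 2 * g) (b - + 2 * h)))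
              (≈-trans (*-cong-mod (Δ₄-odd-even oq ep b a)
                                      (Δ₄-odd-even (odd-shift oq f) (even-shift ep e) _ _))
                          (product≈1 a g)))

-- Powers of 2 in the determinant of ℤ₂³

move : ∀ x y → x ≡ y + (x - y)
move = solve-∀

even-difference : ∀ x y → Even (x - y) → ∃ λ w → x * x - y * y ≡ + 4 * w
even-difference x y (k , eq) =
  k * y + k * k , trans (cong (λ x → x * x - y * y) (trans (move x y) (cong (_+_ y) eq))) (lemma k y)
  where lemma : ∀ k y → (y + + 2 * k) * (y + + 2 * k) - y * y ≡ + 4 * (k * y + k * k)
        lemma = solve-∀

-- With d = x - y odd, x² - y² = d² + 2dy, where d² is 1 and 2dy is 2y modulo 4.
odd-difference : ∀ x y → Odd (x - y) → x * x - y * y ≈ + 2 * y + + 1 [mod + 4 ]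
odd-difference x y (k , eq) =
  k * k + k + k * y , trans (cong (λ x → x * x - y * y) (trans (move x y) (cong (_+_ y) eq))) (lemma k y)
  where lemma : ∀ k y → (y + (+ 2 * k + + 1)) * (y + (+ 2 * k + + 1)) - y * y
                ≡ + 4 * (k * k + k + k * y) + (+ 2 * y + + 1)
        lemma = solve-∀

even-minus-even : ∀ {x y} → Even x → Even y → Even (x - y)
even-minus-even (k , refl) y = subst (λ v → Even (+ 2 * k - v)) (sym (proj₂ y)) (even-shift (k , refl) (proj₁ y))

odd-minus-odd : ∀ {x y} → Odd x → Odd y → Even (x - y)
odd-minus-odd (k , refl) (l , refl) = k - l , lemma k l
  where lemma : ∀ k l → + 2 * k + + 1 - (+ 2 * l + + 1) ≡ + 2 * (k - l)
        lemma = solve-∀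

odd-minus-even : ∀ {x y} → Odd x → Even y → Odd (x - y)
odd-minus-even o (k , refl) = odd-shift o k

swap-minus : ∀ p q a b → p - a - (q - b) ≡ p - q - (a - b)
swap-minus = solve-∀

even-difference-shift : ∀ a b g h → Even (a - b) → Even ((a - + 2 * g) - (b - + 2 * h))
even-difference-shift a b g h e =
  subst Even (lemma a b g h) (even-shift e (g - h))
  where lemma : ∀ a b g h → a - b - + 2 * (g - h) ≡ (a - + 2 * g) - (b - + 2 * h)
        lemma = solve-∀

odd-difference-shift : ∀ a b g h → Odd (a - b) → Odd ((a - + 2 * g) - (b - + 2 * h))
odd-difference-shift a b g h e =
  subst Odd (lemma a b g h) (odd-shift e (g - h))
  where lemma : ∀ a b g h → a - b - + 2 * (g - h) ≡ (a - + 2 * g) - (b - + 2 * h)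
        lemma = solve-∀

Δ₂₂-even-even : ∀ p q a b →
  Δ₂₂ (+ 2 * p) (+ 2 * q) a b ≡ + 16 * ((p * p - q * q) * ((p - a) * (p - a) - (q - b) * (q - b)))
Δ₂₂-even-even = solve 4 (λ p q a b → :Δ₂₂ (con (+ 2) :* p) (con (+ 2) :* q) a b
    := con (+ 16) :* ((p :* p :- q :* q) :* ((p :- a) :* (p :- a) :- (q :- b) :* (q :- b)))) refl

-- After halving p and q, the numbers p - q and (p - a) - (q - b) differ by the odd a - b. Exactly
-- one of them is even, and its difference of squares adds a factor 4 to the 16.
Δ₂₂-even-even-odd : ∀ {p q} → Even p → Even q → ∀ a b → Odd (a - b) → ∃ λ w → Δ₂₂ p q a b ≡ + 64 * w
Δ₂₂-even-even-odd (p , refl) (q , refl) a b o with parity (p - q)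
... | inj₁ e =
  let w , eq = even-difference p q e
      y = (p - a) * (p - a) - (q - b) * (q - b)
  in w * y , trans (Δ₂₂-even-even p q a b) (trans (cong (λ x → + 16 * (x * y)) eq) (lemma w y))
  where lemma : ∀ w y → + 16 * (+ 4 * w * y) ≡ + 64 * (w * y)
        lemma = solve-∀
... | inj₂ o′ =
  let w , eq = even-difference (p - a) (q - b) (subst Even (sym (swap-minus p q a b)) (odd-minus-odd o′ o))
      y = p * p - q * q
  in y * w , trans (Δ₂₂-even-even p q a b) (trans (cong (λ x → + 16 * (y * x)) eq) (lemma w y))
  where lemma : ∀ w y → + 16 * (y * (+ 4 * w)) ≡ + 64 * (y * w)
        lemma = solve-∀

-- After halving p and q, the numbers p - q and (p - a) - (q - b) share a parity. If even, they give
-- 16 · 4 · 4. If odd, the two differences of squares are 2q + 1 and 2(q - b) + 1 modulo 4, and q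
-- drops out of their product; what remains depends only on the parity of `b`, which an even shift
-- preserves.
Δ₂₂-even-even-even : ∀ {p q} → Even p → Even q → ∀ a b → Even (a - b) →
  (∃ λ w → Δ₂₂ p q a b ≡ + 256 * w) ⊎
  (∃ λ w → Δ₂₂ p q a b ≡ + 16 * w × w ≈ + 2 * b + + 1 [mod + 4 ])
Δ₂₂-even-even-even (p , refl) (q , refl) a b e with parity (p - q)
... | inj₁ e′ =
  let w , eq = even-difference p q e′
      w′ , eq′ = even-difference (p - a) (q - b) (subst Even (sym (swap-minus p q a b)) (even-minus-even e′ e))
  in inj₁ (w * w′ , trans (Δ₂₂-even-even p q a b) (trans (cong₂ (λ x y → + 16 * (x * y)) eq eq′) (lemma w w′)))
  where lemma : ∀ w w′ → + 16 * (+ 4 * w * (+ 4 * w′)) ≡ + 256 * (w * w′)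
        lemma = solve-∀
... | inj₂ o = inj₂ (_ , Δ₂₂-even-even p q a b ,
  ≈-trans (*-cong-mod (odd-difference p q o)
                         (odd-difference (p - a) (q - b) (subst Odd (sym (swap-minus p q a b)) (odd-minus-even o e))))
             (q + q * q - q * b - b , lemma q b))
  where
  lemma : ∀ q b → (+ 2 * q + + 1) * (+ 2 * (q - b) + + 1) ≡ + 4 * (q + q * q - q * b - b) + (+ 2 * b + + 1)
  lemma = solve-∀

Z2³-residues : ∀ p q a b e f g h →
  let z = Δ₂₂ p q a b * Δ₂₂ (p - + 2 * e) (q - + 2 * f) (a - + 2 * g) (b - + 2 * h) in
  z ≈ + 1 [mod + 8 ] ⊎ (∃ λ m → z ≡ + 256 * (+ 4 * m + + 1)) ⊎ (∃ λ m → z ≡ + 4096 * m)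
Z2³-residues p q a b e f g h with parity p | parity q
... | inj₂ op | inj₂ oq = inj₂ (inj₂ (*-multiples (+ 64) (+ 64)
  (Δ₂₂-odd-odd op oq a b) (Δ₂₂-odd-odd (odd-shift op e) (odd-shift oq f) _ _)))
... | inj₂ op | inj₁ eq =
  inj₁ (≈-trans (*-cong-mod (Δ₂₂-odd-even op eq a b)
                               (Δ₂₂-odd-even (odd-shift op e) (even-shift eq f) _ _))
                   (product≈1 b h))
... | inj₁ ep | inj₂ oq =
  inj₁ (subst (λ z → z ≈ + 1 [mod + 8 ])
              (cong₂ _*_ (Δ₂₂-swap q p b a)
                         (Δ₂₂-swap (q - + 2 * f) (p - + 2 * e) (b - + 2 * h) (a - + 2 * g)))
              (≈-trans (*-cong-mod (Δ₂₂-odd-even oq ep b a)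
                                      (Δ₂₂-odd-even (odd-shift oq f) (even-shift ep e) _ _))
                          (product≈1 a g)))
... | inj₁ ep | inj₁ eq with parity (a - b)
...   | inj₂ o = inj₂ (inj₂ (*-multiples (+ 64) (+ 64)
  (Δ₂₂-even-even-odd ep eq a b o)
  (Δ₂₂-even-even-odd (even-shift ep e) (even-shift eq f) _ _ (odd-difference-shift a b g h o))))
-- The halves of p and of p - 2e may differ in parity, so here the two factors have to be split
-- independently.
...   | inj₁ o with Δ₂₂-even-even-even ep eq a b o
                  | Δ₂₂-even-even-even (even-shift ep e) (even-shift eq f) _ _ (even-difference-shift a b g h o)
...     | inj₁ d | inj₁ (w′ , d′) =
  inj₂ (inj₂ (*-multiples (+ 256) (+ 16) d (+ 16 * w′ , trans d′ (lemma w′))))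
  where lemma : ∀ w → + 256 * w ≡ + 16 * (+ 16 * w)
        lemma = solve-∀
...     | inj₁ d | inj₂ (w′ , d′ , _) = inj₂ (inj₂ (*-multiples (+ 256) (+ 16) d (w′ , d′)))
...     | inj₂ (w , d , _) | inj₁ d′  = inj₂ (inj₂ (*-multiples (+ 16) (+ 256) (w , d) d′))
...     | inj₂ (w , d , c) | inj₂ (w′ , d′ , c′)
  -- 2b + 1 and 2(b - 2h) + 1 agree modulo 4, and an odd square is 1 there: this is the origin of 4m
  -- + 1.
  with ≈-trans (*-cong-mod c c′) (b - h + b * b - + 2 * b * h , lemma b h)
  where lemma : ∀ b h → (+ 2 * b + + 1) * (+ 2 * (b - + 2 * h) + + 1)
                ≡ + 4 * (b - h + b * b - + 2 * b * h) + + 1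
        lemma = solve-∀
...       | m , eq′ =
  inj₂ (inj₁ (m , trans (proj₂ (*-multiples (+ 16) (+ 16) (w , d) (w′ , d′))) (cong (+ 256 *_) eq′)))

-- Residues of the two factors for Q₈

+-cong-mod : ∀ {n x x′ y y′} → x ≈ y [mod n ] → x′ ≈ y′ [mod n ] → x + x′ ≈ y + y′ [mod n ]
+-cong-mod {n} {y = y} {y′} (k , refl) (k′ , refl) = k + k′ , lemma n k k′ y y′
  where lemma : ∀ n k k′ y y′ → n * k + y + (n * k′ + y′) ≡ n * (k + k′) + (y + y′)
        lemma = solve-∀

even-square-mod4 : ∀ {n} → Even n → n * n ≈ + 0 [mod + 4 ]
even-square-mod4 (k , refl) = k * k , lemma k
  where lemma : ∀ k → + 2 * k * (+ 2 * k) ≡ + 4 * (k * k) + + 0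
        lemma = solve-∀

odd-square-mod4 : ∀ {n} → Odd n → n * n ≈ + 1 [mod + 4 ]
odd-square-mod4 (k , refl) = k * k + k , lemma k
  where lemma : ∀ k → (+ 2 * k + + 1) * (+ 2 * k + + 1) ≡ + 4 * (k * k + k) + + 1
        lemma = solve-∀

even-minus-odd : ∀ {x y} → Even x → Odd y → Odd (x - y)
even-minus-odd (k , refl) (l , refl) = k - l - + 1 , lemma k l
  where lemma : ∀ k l → + 2 * k - (+ 2 * l + + 1) ≡ + 2 * (k - l - + 1) + + 1
        lemma = solve-∀

-- For Q₈ the factor Δ₂₂ is evaluated at the four sums x(g) + x(a²g), and the reduced norm is
-- the sum of the squares of the differences x(g) - x(a²g); the y's are the values x(a²g).
pair : (p a y y′ : ℤ) → ℤ
pair p a y y′ = (p - a - + 2 * y) * (p - a - + 2 * y) + (a - + 2 * y′) * (a - + 2 * y′)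

norm₄ : (p q a b y₀ y₁ y₂ y₃ : ℤ) → ℤ
norm₄ p q a b y₀ y₁ y₂ y₃ = pair p a y₀ y₂ + pair q b y₁ y₃

:pair : ∀ {n} (p a y y′ : Expr n) → Expr n
:pair p a y y′ = (p :- a :- con (+ 2) :* y) :* (p :- a :- con (+ 2) :* y)
  :+ (a :- con (+ 2) :* y′) :* (a :- con (+ 2) :* y′)

:norm₄ : ∀ {n} (p q a b y₀ y₁ y₂ y₃ : Expr n) → Expr n
:norm₄ p q a b y₀ y₁ y₂ y₃ = :pair p a y₀ y₂ :+ :pair q b y₁ y₃

-- p odd makes exactly one of p - a and a odd, whichever parity a has.
pair-odd : ∀ {p} → Odd p → ∀ a y y′ → pair p a y y′ ≈ + 1 [mod + 4 ]
pair-odd o a y y′ with parity a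
... | inj₁ e  = +-cong-mod (odd-square-mod4 (odd-shift (odd-minus-even o e) y)) (even-square-mod4 (even-shift e y′))
... | inj₂ o′ = +-cong-mod (even-square-mod4 (even-shift (odd-minus-odd o o′) y)) (odd-square-mod4 (odd-shift o′ y′))

pair-even-even : ∀ {p a} → Even p → Even a → ∀ y y′ → pair p a y y′ ≈ + 0 [mod + 4 ]
pair-even-even e e′ y y′ =
  +-cong-mod (even-square-mod4 (even-shift (even-minus-even e e′) y)) (even-square-mod4 (even-shift e′ y′))

pair-even-odd : ∀ {p a} → Even p → Odd a → ∀ y y′ → pair p a y y′ ≈ + 2 [mod + 4 ]
pair-even-odd e o y y′ =
  +-cong-mod (odd-square-mod4 (odd-shift (even-minus-odd e o) y)) (odd-square-mod4 (odd-shift o y′))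

square-2mod4 : ∀ {n} → n ≈ + 2 [mod + 4 ] → ∃ λ w → n * n ≡ + 4 * w
square-2mod4 (k , refl) = (+ 2 * k + + 1) * (+ 2 * k + + 1) , lemma k
  where lemma : ∀ k → (+ 4 * k + + 2) * (+ 4 * k + + 2) ≡ + 4 * ((+ 2 * k + + 1) * (+ 2 * k + + 1))
        lemma = solve-∀

square-0mod4 : ∀ {n} → n ≈ + 0 [mod + 4 ] → ∃ λ w → n * n ≡ + 16 * w
square-0mod4 (k , refl) = k * k , lemma k
  where lemma : ∀ k → (+ 4 * k + + 0) * (+ 4 * k + + 0) ≡ + 16 * (k * k)
        lemma = solve-∀

≈4⇒≈0 : ∀ {n} → n ≈ + 4 [mod + 4 ] → n ≈ + 0 [mod + 4 ]
≈4⇒≈0 c = ≈-trans c (+ 1 , refl)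

≈1⇒Odd : ∀ {n} → n ≈ + 1 [mod + 4 ] → Odd n
≈1⇒Odd (k , refl) = + 2 * k , lemma k
  where lemma : ∀ k → + 4 * k + + 1 ≡ + 2 * (+ 2 * k) + + 1
        lemma = solve-∀

Δ₂₂-even-even-16 : ∀ {p q} → Even p → Even q → ∀ a b → ∃ λ w → Δ₂₂ p q a b ≡ + 16 * w
Δ₂₂-even-even-16 (p , refl) (q , refl) a b = _ , Δ₂₂-even-even p q a b

module _ (p q a b y₀ y₁ y₂ y₃ : ℤ) where

  -- q even gives q - b and b the same parity, so `b` odd is the case of three odd arguments. There
  -- L (N N) is -3 modulo 8, and the classes of L and N are kept apart because the prime has to be
  -- found in N.
  Q8-odd-even : Odd p → Even q →
    let L = Δ₂₂ p q a b ; N = norm₄ p q a b y₀ y₁ y₂ y₃ in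
    L * (N * N) ≈ + 1 [mod + 8 ] ⊎ L ≈ - + 3 [mod + 8 ] × N ≈ + 3 [mod + 4 ]
  Q8-odd-even op eq with parity b
  ... | inj₁ eb = inj₁ (*-cong-mod
    (≈-trans (Δ₂₂-odd-even op eq a b) (4b²+1≈1 eb))
    (odd-square (≈1⇒Odd (+-cong-mod (pair-odd op a y₀ y₂) (pair-even-even eq eb y₁ y₃)))))
    where
    4b²+1≈1 : ∀ {b} → Even b → + 4 * (b * b) + + 1 ≈ + 1 [mod + 8 ]
    4b²+1≈1 (k , refl) = + 2 * k * k , lemma k
      where lemma : ∀ k → + 4 * (+ 2 * k * (+ 2 * k)) + + 1 ≡ + 8 * (+ 2 * k * k) + + 1
            lemma = solve-∀
  ... | inj₂ ob = inj₂
    ( ≈-trans (Δ₂₂-odd-even op eq a b) (4b²+1≈-3 ob)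
    , +-cong-mod (pair-odd op a y₀ y₂) (pair-even-odd eq ob y₁ y₃))
    where
    4b²+1≈-3 : ∀ {b} → Odd b → + 4 * (b * b) + + 1 ≈ - + 3 [mod + 8 ]
    4b²+1≈-3 (k , refl) = + 2 * k * k + + 2 * k + + 1 , lemma k
      where lemma : ∀ k → + 4 * ((+ 2 * k + + 1) * (+ 2 * k + + 1)) + + 1
                    ≡ + 8 * (+ 2 * k * k + + 2 * k + + 1) + - + 3
            lemma = solve-∀

-- Every even value reaches 2⁸ as 64 · 4 or 16 · 16. When N is only 2 modulo 4, its square
-- contributes just 4, and the parities that cause this are those that give L the factor 64.
Q8-residues : ∀ p q a b y₀ y₁ y₂ y₃ →
  let L = Δ₂₂ p q a b ; N = norm₄ p q a b y₀ y₁ y₂ y₃ in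
  (∃ λ m → L * (N * N) ≡ + 256 * m)
  ⊎ (L * (N * N) ≈ + 1 [mod + 8 ] ⊎ L ≈ - + 3 [mod + 8 ] × N ≈ + 3 [mod + 4 ])
Q8-residues p q a b y₀ y₁ y₂ y₃ with parity p | parity q
... | inj₂ op | inj₂ oq = inj₁ (*-multiples (+ 64) (+ 4)
  (Δ₂₂-odd-odd op oq a b) (square-2mod4 (+-cong-mod (pair-odd op a y₀ y₂) (pair-odd oq b y₁ y₃))))
... | inj₂ op | inj₁ eq = inj₂ (Q8-odd-even p q a b y₀ y₁ y₂ y₃ op eq)
... | inj₁ ep | inj₂ oq
  rewrite Δ₂₂-swap p q a b | +-comm (pair p a y₀ y₂) (pair q b y₁ y₃) =
  inj₂ (Q8-odd-even q p b a y₁ y₀ y₃ y₂ oq ep)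
... | inj₁ ep | inj₁ eq with parity a | parity b
...   | inj₁ ea | inj₁ eb = inj₁ (*-multiples (+ 16) (+ 16)
  (Δ₂₂-even-even-16 ep eq a b)
  (square-0mod4 (+-cong-mod (pair-even-even ep ea y₀ y₂) (pair-even-even eq eb y₁ y₃))))
...   | inj₂ oa | inj₂ ob = inj₁ (*-multiples (+ 16) (+ 16)
  (Δ₂₂-even-even-16 ep eq a b)
  (square-0mod4 (≈4⇒≈0 (+-cong-mod (pair-even-odd ep oa y₀ y₂) (pair-even-odd eq ob y₁ y₃)))))
...   | inj₁ ea | inj₂ ob = inj₁ (*-multiples (+ 64) (+ 4)
  (Δ₂₂-even-even-odd ep eq a b (even-minus-odd ea ob))
  (square-2mod4 (+-cong-mod (pair-even-even ep ea y₀ y₂) (pair-even-odd eq ob y₁ y₃))))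
...   | inj₂ oa | inj₁ eb = inj₁ (*-multiples (+ 64) (+ 4)
  (Δ₂₂-even-even-odd ep eq a b (odd-minus-even oa eb))
  (square-2mod4 (+-cong-mod (pair-even-odd ep oa y₀ y₂) (pair-even-even eq eb y₁ y₃))))

-- Sums of four squares

infixl 8 _²
_² : ℤ → ℤ
x ² = x * x

_²ᵉ : ∀ {n} → Expr n → Expr n
x ²ᵉ = x :* x

record SumOfFourSquares (n : ℤ) : Set where
  constructor four
  field
    a b c d  : ℤ
    equality : n ≡ a ² + b ² + c ² + d ²

square-abs : ∀ i → + (∣ i ∣ ℕ.* ∣ i ∣) ≡ i ²
square-abs (+ n)    = pos-* n n
square-abs -[1+ n ] = refl

-- The bound cannot be strict for even m. The extreme case, all four remainders equal to half of m
-- in absolute value, is refuted later by `R≢m`.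
record CentredDivision (m : ℕ) (x : ℤ) : Set where
  constructor centred
  field
    remainder quotient : ℤ
    division : x ≡ remainder + + m * quotient
    bound    : 2 ℕ.* ∣ remainder ∣ ≤ m

centredDivision : ∀ m .{{_ : NonZero m}} x → CentredDivision m x
centredDivision m x with 2 ℕ.* (x %ℕ m) ℕ.≤? m
... | yes 2r≤m = centred (+ (x %ℕ m)) (x /ℕ m)
  (trans (a≡a%ℕn+[a/ℕn]*n x m) (lemma (+ (x %ℕ m)) (x /ℕ m) (+ m))) 2r≤m
  where lemma : ∀ r q m → r + q * m ≡ r + m * q
        lemma = solve-∀
... | no 2r≰m = centred (- + s) (x /ℕ m + + 1) (begin
    x                                  ≡⟨ a≡a%ℕn+[a/ℕn]*n x m ⟩
    + r + x /ℕ m * + m                 ≡⟨ cong (λ v → + r + x /ℕ m * v) m≡s+r ⟩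
    + r + x /ℕ m * (+ s + + r)         ≡⟨ lemma (+ r) (+ s) (x /ℕ m) ⟩
    - + s + (+ s + + r) * (x /ℕ m + + 1) ≡⟨ cong (λ v → - + s + v * (x /ℕ m + + 1)) m≡s+r ⟨
    - + s + + m * (x /ℕ m + + 1)       ∎)
  (subst (λ v → 2 ℕ.* v ≤ m) (sym (∣-i∣≡∣i∣ (+ s))) 2s≤m)
  where
  open ≡-Reasoning
  r s : ℕ
  r = x %ℕ m
  s = m ∸ r
  r≤m : r ≤ m
  r≤m = ℕ.<⇒≤ (n%ℕd<d x m)
  m≡s+r : + m ≡ + s + + r
  m≡s+r = trans (cong +_ (sym (ℕ.m∸n+n≡m r≤m))) (pos-+ s r)
  lemma : ∀ r s q → r + q * (s + r) ≡ - s + (s + r) * (q + + 1)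
  lemma = solve-∀
  2s≤m : 2 ℕ.* s ≤ m
  2s≤m = subst (_≤ m) (sym (ℕ.*-distribˡ-∸ 2 m r))
    (ℕ.m≤n+o⇒m∸n≤o (2 ℕ.* m) (2 ℕ.* r) {m}
      (subst (_≤ 2 ℕ.* r ℕ.+ m) (cong (m ℕ.+_) (sym (ℕ.+-identityʳ m)))
        (ℕ.+-monoˡ-≤ m (ℕ.<⇒≤ (ℕ.≰⇒> 2r≰m)))))

≤-sum-≡ : ∀ {x y M N} → x ≤ M → y ≤ N → x ℕ.+ y ≡ M ℕ.+ N → x ≡ M × y ≡ N
≤-sum-≡ {x} {y} {M} {N} x≤M y≤N eq =
  ℕ.≤-antisym x≤M (ℕ.+-cancelʳ-≤ N M x (ℕ.≤-trans (ℕ.≤-reflexive (sym eq)) (ℕ.+-monoʳ-≤ x y≤N))) ,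
  ℕ.≤-antisym y≤N (ℕ.+-cancelˡ-≤ M N y (ℕ.≤-trans (ℕ.≤-reflexive (sym eq)) (ℕ.+-monoˡ-≤ y x≤M)))

square-injective : ∀ {m n} → m ≤ n → m ℕ.* m ≡ n ℕ.* n → m ≡ n
square-injective {m} {n} m≤n eq with ℕ.m≤n⇒m<n∨m≡n m≤n
... | inj₂ m≡n = m≡n
... | inj₁ m<n = ⊥-elim (ℕ.<-irrefl eq (ℕ.*-mono-< m<n m<n))

4*-squares : ∀ a b c d →
  2 ℕ.* a ℕ.* (2 ℕ.* a) ℕ.+ 2 ℕ.* b ℕ.* (2 ℕ.* b) ℕ.+ (2 ℕ.* c ℕ.* (2 ℕ.* c) ℕ.+ 2 ℕ.* d ℕ.* (2 ℕ.* d))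
  ≡ 4 ℕ.* (a ℕ.* a ℕ.+ b ℕ.* b ℕ.+ (c ℕ.* c ℕ.+ d ℕ.* d))
4*-squares = solve-ℕ

4*-copies : ∀ a → a ℕ.+ a ℕ.+ (a ℕ.+ a) ≡ 4 ℕ.* a
4*-copies = solve-ℕ

module _ {m : ℕ} (a b c d : ℕ)
  (a≤ : 2 ℕ.* a ≤ m) (b≤ : 2 ℕ.* b ≤ m) (c≤ : 2 ℕ.* c ≤ m) (d≤ : 2 ℕ.* d ≤ m) where

  -- Each square is at most a quarter of m²; multiplying through by 4 avoids halving m. Equality in
  -- the total then forces equality in every summand, which is `sum-of-squares-≡`.
  sum-of-squares-≤ : a ℕ.* a ℕ.+ b ℕ.* b ℕ.+ (c ℕ.* c ℕ.+ d ℕ.* d) ≤ m ℕ.* m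
  sum-of-squares-≤ = ℕ.*-cancelˡ-≤ 4 (subst₂ _≤_ (4*-squares a b c d) (4*-copies (m ℕ.* m))
    (ℕ.+-mono-≤ (ℕ.+-mono-≤ (ℕ.*-mono-≤ a≤ a≤) (ℕ.*-mono-≤ b≤ b≤))
                (ℕ.+-mono-≤ (ℕ.*-mono-≤ c≤ c≤) (ℕ.*-mono-≤ d≤ d≤))))

  sum-of-squares-≡ : a ℕ.* a ℕ.+ b ℕ.* b ℕ.+ (c ℕ.* c ℕ.+ d ℕ.* d) ≡ m ℕ.* m →
    2 ℕ.* a ≡ m × 2 ℕ.* b ≡ m × 2 ℕ.* c ≡ m × 2 ℕ.* d ≡ m
  sum-of-squares-≡ eq
    with ab , cd ← ≤-sum-≡ (ℕ.+-mono-≤ (ℕ.*-mono-≤ a≤ a≤) (ℕ.*-mono-≤ b≤ b≤))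
                           (ℕ.+-mono-≤ (ℕ.*-mono-≤ c≤ c≤) (ℕ.*-mono-≤ d≤ d≤))
                           (trans (4*-squares a b c d) (trans (cong (4 ℕ.*_) eq) (sym (4*-copies (m ℕ.* m)))))
    with a² , b² ← ≤-sum-≡ (ℕ.*-mono-≤ a≤ a≤) (ℕ.*-mono-≤ b≤ b≤) ab
       | c² , d² ← ≤-sum-≡ (ℕ.*-mono-≤ c≤ c≤) (ℕ.*-mono-≤ d≤ d≤) cd =
    square-injective a≤ a² , square-injective b≤ b² , square-injective c≤ c² , square-injective d≤ d²

-- One step of Lagrange's descent from m to a smaller multiplier. `r` comes with the equation `p≡`
-- and is not obtained by division: multiplying `p≡` by m and subtracting it from the expanded `mp≡`
-- leaves ∑y² = m r, so divisibility by m needs no argument of its own.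
module Descent (p m : ℕ) .{{_ : NonZero m}} (p-prime : Prime p) (1<m : 1 < m) (m<p : m < p)
  (y₀ y₁ y₂ y₃ k₀ k₁ k₂ k₃ : ℤ)
  (y₀≤ : 2 ℕ.* ∣ y₀ ∣ ≤ m) (y₁≤ : 2 ℕ.* ∣ y₁ ∣ ≤ m) (y₂≤ : 2 ℕ.* ∣ y₂ ∣ ≤ m) (y₃≤ : 2 ℕ.* ∣ y₃ ∣ ≤ m)
  (mp≡ : + m * + p ≡ (y₀ + + m * k₀) ² + (y₁ + + m * k₁) ² + (y₂ + + m * k₂) ² + (y₃ + + m * k₃) ²)
  (r : ℤ)
  (p≡ : + p ≡ r + + 2 * (k₀ * y₀ + k₁ * y₁ + k₂ * y₂ + k₃ * y₃) + + m * (k₀ ² + k₁ ² + k₂ ² + k₃ ²)) where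

  ∑y² ∑k² ∑ky : ℤ
  ∑y² = y₀ ² + y₁ ² + y₂ ² + y₃ ²
  ∑k² = k₀ ² + k₁ ² + k₂ ² + k₃ ²
  ∑ky = k₀ * y₀ + k₁ * y₁ + k₂ * y₂ + k₃ * y₃

  ∑y²≡mr : ∑y² ≡ + m * r
  ∑y²≡mr = trans (expand y₀ y₁ y₂ y₃ k₀ k₁ k₂ k₃ (+ m))
    (trans (cong (λ v → v - + m * (+ 2 * ∑ky) - + m * (+ m * ∑k²)) (sym mp≡))
      (trans (cong (λ v → + m * v - + m * (+ 2 * ∑ky) - + m * (+ m * ∑k²)) p≡) (collect (+ m) r ∑ky ∑k²)))
    where
    expand : ∀ y₀ y₁ y₂ y₃ k₀ k₁ k₂ k₃ m → y₀ ² + y₁ ² + y₂ ² + y₃ ² ≡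
      (y₀ + m * k₀) ² + (y₁ + m * k₁) ² + (y₂ + m * k₂) ² + (y₃ + m * k₃) ²
      - m * (+ 2 * (k₀ * y₀ + k₁ * y₁ + k₂ * y₂ + k₃ * y₃)) - m * (m * (k₀ ² + k₁ ² + k₂ ² + k₃ ²))
    expand = solve 9 (λ y₀ y₁ y₂ y₃ k₀ k₁ k₂ k₃ m → y₀ ²ᵉ :+ y₁ ²ᵉ :+ y₂ ²ᵉ :+ y₃ ²ᵉ :=
      (y₀ :+ m :* k₀) ²ᵉ :+ (y₁ :+ m :* k₁) ²ᵉ :+ (y₂ :+ m :* k₂) ²ᵉ :+ (y₃ :+ m :* k₃) ²ᵉ
      :- m :* (con (+ 2) :* (k₀ :* y₀ :+ k₁ :* y₁ :+ k₂ :* y₂ :+ k₃ :* y₃))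
      :- m :* (m :* (k₀ ²ᵉ :+ k₁ ²ᵉ :+ k₂ ²ᵉ :+ k₃ ²ᵉ))) refl
    collect : ∀ m r s t → m * (r + + 2 * s + m * t) - m * (+ 2 * s) - m * (m * t) ≡ m * r
    collect = solve-∀

  S R : ℕ
  S = ∣ y₀ ∣ ℕ.* ∣ y₀ ∣ ℕ.+ ∣ y₁ ∣ ℕ.* ∣ y₁ ∣ ℕ.+ (∣ y₂ ∣ ℕ.* ∣ y₂ ∣ ℕ.+ ∣ y₃ ∣ ℕ.* ∣ y₃ ∣)
  R = ∣ r ∣

  S≡∑y² : + S ≡ ∑y²
  S≡∑y² = trans (pos-+ (∣ y₀ ∣ ℕ.* ∣ y₀ ∣ ℕ.+ ∣ y₁ ∣ ℕ.* ∣ y₁ ∣) _) (trans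
    (cong₂ _+_ (trans (pos-+ (∣ y₀ ∣ ℕ.* ∣ y₀ ∣) _) (cong₂ _+_ (square-abs y₀) (square-abs y₁)))
               (trans (pos-+ (∣ y₂ ∣ ℕ.* ∣ y₂ ∣) _) (cong₂ _+_ (square-abs y₂) (square-abs y₃))))
    (assoc (y₀ ²) (y₁ ²) (y₂ ²) (y₃ ²)))
    where assoc : ∀ a b c d → a + b + (c + d) ≡ a + b + c + d
          assoc = solve-∀

  S≡mR : S ≡ m ℕ.* R
  S≡mR = trans (cong ∣_∣ (trans S≡∑y² ∑y²≡mr)) (abs-* (+ m) r)

  cancel : ∀ {u v} → + m * u ≡ + m * v → u ≡ v
  cancel = *-cancelˡ-≡ (+ m) _ _
    {{ℤ.≢-nonZero (λ eq → ℕ.<-irrefl (sym (+-injective eq)) (ℕ.<-trans ℕ.z<s 1<m))}}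

  r≡R : r ≡ + R
  r≡R = cancel (trans (sym (trans S≡∑y² ∑y²≡mr)) (trans (cong +_ S≡mR) (pos-* m R)))

  R≤m : R ≤ m
  R≤m = ℕ.*-cancelˡ-≤ m (subst (_≤ m ℕ.* m) S≡mR
    (sum-of-squares-≤ (∣ y₀ ∣) (∣ y₁ ∣) (∣ y₂ ∣) (∣ y₃ ∣) y₀≤ y₁≤ y₂≤ y₃≤))

  m∤p : ∀ w → + p ≢ + m * w
  m∤p w p≡mw with prime⇒irreducible p-prime
    (divides ∣ w ∣ (trans (cong ∣_∣ p≡mw) (trans (abs-* (+ m) w) (ℕ.*-comm m ∣ w ∣))))
  ... | inj₁ m≡1 = ℕ.<-irrefl (sym m≡1) 1<m
  ... | inj₂ m≡p = ℕ.<-irrefl m≡p m<p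

  -- In `p≡` the y's occur only doubled, so these divisibilities would make m divide p, although 1 <
  -- m < p. Asking for 2y and not y serves both ends: all y zero (`R≢0`) and all y at half of m
  -- (`R≢m`).
  no-common-factor : (∃ λ s → r ≡ + m * s) →
    (∃ λ t → + 2 * y₀ ≡ + m * t) → (∃ λ t → + 2 * y₁ ≡ + m * t) →
    (∃ λ t → + 2 * y₂ ≡ + m * t) → (∃ λ t → + 2 * y₃ ≡ + m * t) → ⊥
  no-common-factor (s , r≡) (t₀ , e₀) (t₁ , e₁) (t₂ , e₂) (t₃ , e₃) =
    m∤p (s + (k₀ * t₀ + k₁ * t₁ + k₂ * t₂ + k₃ * t₃) + ∑k²) (begin
      + p
        ≡⟨ p≡ ⟩
      r + + 2 * ∑ky + + m * ∑k²
        ≡⟨ cong₂ (λ u v → u + v + + m * ∑k²) r≡ (distribute y₀ y₁ y₂ y₃ k₀ k₁ k₂ k₃) ⟩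
      + m * s + (k₀ * (+ 2 * y₀) + k₁ * (+ 2 * y₁) + k₂ * (+ 2 * y₂) + k₃ * (+ 2 * y₃)) + + m * ∑k²
        ≡⟨ cong (λ v → + m * s + v + + m * ∑k²) (cong₂ _+_ (cong₂ _+_ (cong₂ _+_
             (cong (k₀ *_) e₀) (cong (k₁ *_) e₁)) (cong (k₂ *_) e₂)) (cong (k₃ *_) e₃)) ⟩
      + m * s + (k₀ * (+ m * t₀) + k₁ * (+ m * t₁) + k₂ * (+ m * t₂) + k₃ * (+ m * t₃)) + + m * ∑k²
        ≡⟨ collect (+ m) s t₀ t₁ t₂ t₃ k₀ k₁ k₂ k₃ ∑k² ⟩
      + m * (s + (k₀ * t₀ + k₁ * t₁ + k₂ * t₂ + k₃ * t₃) + ∑k²) ∎)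
    where
    open ≡-Reasoning
    distribute : ∀ y₀ y₁ y₂ y₃ k₀ k₁ k₂ k₃ → + 2 * (k₀ * y₀ + k₁ * y₁ + k₂ * y₂ + k₃ * y₃)
      ≡ k₀ * (+ 2 * y₀) + k₁ * (+ 2 * y₁) + k₂ * (+ 2 * y₂) + k₃ * (+ 2 * y₃)
    distribute = solve-∀
    collect : ∀ m s t₀ t₁ t₂ t₃ k₀ k₁ k₂ k₃ t →
      m * s + (k₀ * (m * t₀) + k₁ * (m * t₁) + k₂ * (m * t₂) + k₃ * (m * t₃)) + m * t
      ≡ m * (s + (k₀ * t₀ + k₁ * t₁ + k₂ * t₂ + k₃ * t₃) + t)
    collect = solve 11 (λ m s t₀ t₁ t₂ t₃ k₀ k₁ k₂ k₃ t →
      m :* s :+ (k₀ :* (m :* t₀) :+ k₁ :* (m :* t₁) :+ k₂ :* (m :* t₂) :+ k₃ :* (m :* t₃)) :+ m :* t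
      := m :* (s :+ (k₀ :* t₀ :+ k₁ :* t₁ :+ k₂ :* t₂ :+ k₃ :* t₃) :+ t)) refl

  R≢0 : R ≢ 0
  R≢0 R≡0 = no-common-factor
    (+ 0 , trans r≡R (trans (cong +_ R≡0) (sym m*0)))
    (vanish y₀ e₀) (vanish y₁ e₁) (vanish y₂ e₂) (vanish y₃ e₃)
    where
    m*0 : + m * + 0 ≡ + 0
    m*0 = lemma (+ m)
      where lemma : ∀ m → m * + 0 ≡ + 0
            lemma = solve-∀
    S≡0 : S ≡ 0
    S≡0 = trans S≡mR (trans (cong (m ℕ.*_) R≡0) (ℕ.*-zeroʳ m))
    vanish : ∀ y → ∣ y ∣ ℕ.* ∣ y ∣ ≡ 0 → ∃ λ t → + 2 * y ≡ + m * t
    vanish y e = + 0 , trans (cong (+ 2 *_) (∣i∣≡0⇒i≡0 (reduce (ℕ.m*n≡0⇒m≡0∨n≡0 ∣ y ∣ e)))) (sym m*0)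
    e₀₁ = ℕ.m+n≡0⇒m≡0 (∣ y₀ ∣ ℕ.* ∣ y₀ ∣ ℕ.+ ∣ y₁ ∣ ℕ.* ∣ y₁ ∣) S≡0
    e₂₃ = ℕ.m+n≡0⇒n≡0 (∣ y₀ ∣ ℕ.* ∣ y₀ ∣ ℕ.+ ∣ y₁ ∣ ℕ.* ∣ y₁ ∣) S≡0
    e₀ = ℕ.m+n≡0⇒m≡0 (∣ y₀ ∣ ℕ.* ∣ y₀ ∣) e₀₁
    e₁ = ℕ.m+n≡0⇒n≡0 (∣ y₀ ∣ ℕ.* ∣ y₀ ∣) e₀₁
    e₂ = ℕ.m+n≡0⇒m≡0 (∣ y₂ ∣ ℕ.* ∣ y₂ ∣) e₂₃
    e₃ = ℕ.m+n≡0⇒n≡0 (∣ y₂ ∣ ℕ.* ∣ y₂ ∣) e₂₃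

  R≢m : R ≢ m
  R≢m R≡m =
    let e₀ , e₁ , e₂ , e₃ = sum-of-squares-≡ (∣ y₀ ∣) (∣ y₁ ∣) (∣ y₂ ∣) (∣ y₃ ∣) y₀≤ y₁≤ y₂≤ y₃≤
                              (trans S≡mR (cong (m ℕ.*_) R≡m))
    in no-common-factor (+ 1 , trans r≡R (trans (cong +_ R≡m) (*1 (+ m))))
         (extreme y₀ e₀) (extreme y₁ e₁) (extreme y₂ e₂) (extreme y₃ e₃)
    where
    *1 : ∀ m → m ≡ m * + 1
    *1 = solve-∀
    extreme : ∀ y → 2 ℕ.* ∣ y ∣ ≡ m → ∃ λ t → + 2 * y ≡ + m * t
    extreme y e with +∣i∣≡i⊎+∣i∣≡-i y
    ... | inj₁ eq = + 1 , trans (cong (+ 2 *_) (sym eq))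
      (trans (sym (pos-* 2 ∣ y ∣)) (trans (cong +_ e) (*1 (+ m))))
    ... | inj₂ eq = - + 1 , trans (flip y) (trans (cong (λ v → (- + 1) * (+ 2 * v)) (sym eq))
      (trans (cong ((- + 1) *_) (trans (sym (pos-* 2 ∣ y ∣)) (cong +_ e))) (comm (+ m))))
      where
      flip : ∀ y → + 2 * y ≡ (- + 1) * (+ 2 * - y)
      flip = solve-∀
      comm : ∀ m → (- + 1) * m ≡ m * - + 1
      comm = solve-∀

  -- Euler's four-square identity applied to x = y + m k and y: each of the four resulting
  -- entries is a multiple of m.
  euler : ∀ y₀ y₁ y₂ y₃ k₀ k₁ k₂ k₃ m →
    ((y₀ + m * k₀) ² + (y₁ + m * k₁) ² + (y₂ + m * k₂) ² + (y₃ + m * k₃) ²) * (y₀ ² + y₁ ² + y₂ ² + y₃ ²) ≡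
    (y₀ ² + y₁ ² + y₂ ² + y₃ ² + m * (k₀ * y₀ + k₁ * y₁ + k₂ * y₂ + k₃ * y₃)) ²
    + m * m * ((k₀ * y₁ - k₁ * y₀ + k₂ * y₃ - k₃ * y₂) ²
             + (k₀ * y₂ - k₂ * y₀ + k₃ * y₁ - k₁ * y₃) ²
             + (k₀ * y₃ - k₃ * y₀ + k₁ * y₂ - k₂ * y₁) ²)
  euler = solve 9 (λ y₀ y₁ y₂ y₃ k₀ k₁ k₂ k₃ m →
    ((y₀ :+ m :* k₀) ²ᵉ :+ (y₁ :+ m :* k₁) ²ᵉ :+ (y₂ :+ m :* k₂) ²ᵉ :+ (y₃ :+ m :* k₃) ²ᵉ)
      :* (y₀ ²ᵉ :+ y₁ ²ᵉ :+ y₂ ²ᵉ :+ y₃ ²ᵉ) :=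
    (y₀ ²ᵉ :+ y₁ ²ᵉ :+ y₂ ²ᵉ :+ y₃ ²ᵉ :+ m :* (k₀ :* y₀ :+ k₁ :* y₁ :+ k₂ :* y₂ :+ k₃ :* y₃)) ²ᵉ
    :+ m :* m :* ((k₀ :* y₁ :- k₁ :* y₀ :+ k₂ :* y₃ :- k₃ :* y₂) ²ᵉ
             :+ (k₀ :* y₂ :- k₂ :* y₀ :+ k₃ :* y₁ :- k₁ :* y₃) ²ᵉ
             :+ (k₀ :* y₃ :- k₃ :* y₀ :+ k₁ :* y₂ :- k₂ :* y₁) ²ᵉ)) refl

  descend : SumOfFourSquares (+ R * + p)
  -- These are Euler's entries already divided by m: the first, ∑y² + m ∑ky, equals m (r + ∑ky).
  -- Both sides then carry m², which is cancelled twice.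
  descend = four (r + ∑ky) w₁ w₂ w₃ (trans (cong (_* + p) (sym r≡R)) (cancel (cancel (begin
    + m * (+ m * (r * + p))                      ≡⟨ group (+ m) r (+ p) ⟩
    + m * + p * (+ m * r)                        ≡⟨ cong₂ _*_ mp≡ (sym ∑y²≡mr) ⟩
    _                                            ≡⟨ euler y₀ y₁ y₂ y₃ k₀ k₁ k₂ k₃ (+ m) ⟩
    (∑y² + + m * ∑ky) ² + + m * + m * ∑w²        ≡⟨ cong (λ v → (v + + m * ∑ky) ² + + m * + m * ∑w²) ∑y²≡mr ⟩
    (+ m * r + + m * ∑ky) ² + + m * + m * ∑w²    ≡⟨ collect (+ m) r ∑ky (w₁ ²) (w₂ ²) (w₃ ²) ⟩
    + m * (+ m * ((r + ∑ky) ² + w₁ ² + w₂ ² + w₃ ²)) ∎))))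
    where
    open ≡-Reasoning
    w₁ w₂ w₃ ∑w² : ℤ
    w₁ = k₀ * y₁ - k₁ * y₀ + k₂ * y₃ - k₃ * y₂
    w₂ = k₀ * y₂ - k₂ * y₀ + k₃ * y₁ - k₁ * y₃
    w₃ = k₀ * y₃ - k₃ * y₀ + k₁ * y₂ - k₂ * y₁
    ∑w² = w₁ ² + w₂ ² + w₃ ²
    group : ∀ m r p → m * (m * (r * p)) ≡ m * p * (m * r)
    group = solve-∀
    collect : ∀ m r s a b c → (m * r + m * s) * (m * r + m * s) + m * m * (a + b + c)
              ≡ m * (m * ((r + s) * (r + s) + a + b + c))
    collect = solve-∀

descent : ∀ {p} → Prime p → ∀ m → Acc _<_ m → 0 < m → m < p →
  SumOfFourSquares (+ m * + p) → SumOfFourSquares (+ p)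
descent p-prime 1 _ _ _ s = subst SumOfFourSquares (1* _) s
  where 1* : ∀ p → + 1 * p ≡ p
        1* = solve-∀
descent {p} p-prime m@(suc (suc _)) (acc rec) _ m<p (four x₀ x₁ x₂ x₃ eq)
  with centredDivision m x₀ | centredDivision m x₁ | centredDivision m x₂ | centredDivision m x₃
... | centred y₀ k₀ refl y₀≤ | centred y₁ k₁ refl y₁≤ | centred y₂ k₂ refl y₂≤ | centred y₃ k₃ refl y₃≤ =
  descent p-prime R (rec R<m) (ℕ.n≢0⇒n>0 R≢0) (ℕ.<-trans R<m m<p) descend
  where
  add-back : ∀ p s t → p ≡ p - s - t + s + t
  add-back = solve-∀
  open Descent p m p-prime (ℕ.s<s ℕ.z<s) m<p y₀ y₁ y₂ y₃ k₀ k₁ k₂ k₃ y₀≤ y₁≤ y₂≤ y₃≤ eq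
    (+ p - + 2 * (k₀ * y₀ + k₁ * y₁ + k₂ * y₂ + k₃ * y₃) - + m * (k₀ ² + k₁ ² + k₂ ² + k₃ ²))
    (add-back (+ p) (+ 2 * (k₀ * y₀ + k₁ * y₁ + k₂ * y₂ + k₃ * y₃)) (+ m * (k₀ ² + k₁ ² + k₂ ² + k₃ ²)))
  R<m : R < m
  R<m = ℕ.≤∧≢⇒< R≤m R≢m

-- Half of the residues suffice: 0², …, h² are distinct modulo p = 2h + 1, and so are
-- the -1 - j², so two of these 2h + 2 residues, one of each kind, coincide.
module _ (h : ℕ) (0<h : 0 < h) (p-prime : Prime (suc (h ℕ.+ h))) where

  private
    p : ℕ
    p = suc (h ℕ.+ h)

  square-residue : ℕ → Fin p
  square-residue i = fromℕ< (m%n<n (i ℕ.* i) p)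

  toℕ-square-residue : ∀ i → toℕ (square-residue i) ≡ i ℕ.* i % p
  toℕ-square-residue i = toℕ-fromℕ< (m%n<n (i ℕ.* i) p)

  private
    d+i≤h : ∀ {i j} → i < j → j ≤ h → suc (j ∸ suc i) ℕ.+ i ≤ h
    d+i≤h {i} i<j j≤h =
      ℕ.≤-trans (ℕ.≤-reflexive (trans (sym (ℕ.+-suc _ i)) (ℕ.m∸n+n≡m i<j))) j≤h

  -- p would divide j² - i² = (j - i)(j + i), hence one factor, yet both are positive and at most
  -- 2h. Subtraction is avoided by writing j as `suc d + i`, which also shows the first factor to be
  -- nonzero.
  square-residues-distinct : ∀ {i j} → i < j → j ≤ h → square-residue i ≢ square-residue j
  square-residues-distinct {i} {j} i<j j≤h eq
    with euclidsLemma (suc d) (suc d ℕ.+ i ℕ.+ i) p-prime p∣product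
    where
    d : ℕ
    d = j ∸ suc i
    j≡ : j ≡ suc d ℕ.+ i
    j≡ = trans (sym (ℕ.m∸n+n≡m i<j)) (ℕ.+-suc d i)
    difference : ∀ d i → i ℕ.* i ℕ.+ d ℕ.* (d ℕ.+ i ℕ.+ i) ≡ (d ℕ.+ i) ℕ.* (d ℕ.+ i)
    difference = solve-ℕ
    same : i ℕ.* i % p ≡ j ℕ.* j % p
    same = trans (sym (toℕ-square-residue i)) (trans (cong toℕ eq) (toℕ-square-residue j))
    X : ℕ
    X = suc d ℕ.* (suc d ℕ.+ i ℕ.+ i)
    quotients : i ℕ.* i / p ℕ.* p ℕ.+ X ≡ j ℕ.* j / p ℕ.* p
    quotients = ℕ.+-cancelˡ-≡ (i ℕ.* i % p) _ _ (begin
      i ℕ.* i % p ℕ.+ (i ℕ.* i / p ℕ.* p ℕ.+ X) ≡⟨ ℕ.+-assoc (i ℕ.* i % p) _ _ ⟨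
      i ℕ.* i % p ℕ.+ i ℕ.* i / p ℕ.* p ℕ.+ X   ≡⟨ cong (ℕ._+ X) (m≡m%n+[m/n]*n (i ℕ.* i) p) ⟨
      i ℕ.* i ℕ.+ X                             ≡⟨ difference (suc d) i ⟩
      (suc d ℕ.+ i) ℕ.* (suc d ℕ.+ i)           ≡⟨ cong₂ ℕ._*_ j≡ j≡ ⟨
      j ℕ.* j                                   ≡⟨ m≡m%n+[m/n]*n (j ℕ.* j) p ⟩
      j ℕ.* j % p ℕ.+ j ℕ.* j / p ℕ.* p         ≡⟨ cong (ℕ._+ j ℕ.* j / p ℕ.* p) same ⟨
      i ℕ.* i % p ℕ.+ j ℕ.* j / p ℕ.* p         ∎)
      where open ≡-Reasoning
    p∣product : p ∣ X
    p∣product = ∣m+n∣m⇒∣n (divides (j ℕ.* j / p) quotients) (divides (i ℕ.* i / p) refl)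
  ... | inj₁ p∣d =
    ℕ.<⇒≱ (s≤s (ℕ.≤-trans (ℕ.≤-trans (ℕ.m≤m+n _ i) (d+i≤h i<j j≤h)) (ℕ.m≤m+n h h))) (∣⇒≤ p∣d)
  ... | inj₂ p∣d+2i =
    ℕ.<⇒≱ (s≤s (ℕ.+-mono-≤ (d+i≤h i<j j≤h) (ℕ.≤-trans (ℕ.<⇒≤ i<j) j≤h))) (∣⇒≤ p∣d+2i)

  square-residue-injective : ∀ {i j} → i ≤ h → j ≤ h → square-residue i ≡ square-residue j → i ≡ j
  square-residue-injective {i} {j} i≤h j≤h eq with ℕ.<-cmp i j
  ... | tri< i<j _ _ = ⊥-elim (square-residues-distinct i<j j≤h eq)
  ... | tri≈ _ i≡j _ = i≡j
  ... | tri> _ _ j<i = ⊥-elim (square-residues-distinct j<i i≤h (sym eq))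

  -- `opposite` sends r to p - 1 - r, so on the second summand it yields the residue of -1 - j².
  residue : Fin (suc h) ⊎ Fin (suc h) → Fin p
  residue (inj₁ i) = square-residue (toℕ i)
  residue (inj₂ j) = opposite (square-residue (toℕ j))

  opposite-residues : ∃ λ (i : Fin (suc h)) → ∃ λ (j : Fin (suc h)) →
    square-residue (toℕ i) ≡ opposite (square-residue (toℕ j))
  opposite-residues
    with i , j , i<j , eq ← pigeonhole {p} {suc h ℕ.+ suc h}
                              (s≤s (ℕ.≤-reflexive (sym (ℕ.+-suc h h)))) (residue ∘ splitAt (suc h))
    with splitAt (suc h) i in i≡ | splitAt (suc h) j in j≡
  ... | inj₁ k | inj₂ l = k , l , eq
  ... | inj₂ k | inj₁ l = l , k , sym eq
  ... | inj₁ k | inj₁ l = ⊥-elim (ℕ.<-irrefl (cong toℕ (trans (sym (splitAt⁻¹-↑ˡ i≡))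
    (trans (cong (Fin._↑ˡ suc h) k≡l) (splitAt⁻¹-↑ˡ j≡)))) i<j)
    where
    k≡l : k ≡ l
    k≡l = toℕ-injective (square-residue-injective (toℕ≤pred[n] k) (toℕ≤pred[n] l) eq)
  ... | inj₂ k | inj₂ l = ⊥-elim (ℕ.<-irrefl (cong toℕ (trans (sym (splitAt⁻¹-↑ʳ i≡))
    (trans (cong (suc h Fin.↑ʳ_) k≡l) (splitAt⁻¹-↑ʳ j≡)))) i<j)
    where
    k≡l : k ≡ l
    k≡l = toℕ-injective (square-residue-injective (toℕ≤pred[n] k) (toℕ≤pred[n] l)
      (trans (sym (opposite-involutive _)) (trans (cong opposite eq) (opposite-involutive _))))

  multiple-of-p : ∃ λ m → 0 < m × m < p × SumOfFourSquares (+ m * + p)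
  multiple-of-p with i′ , j′ , eq ← opposite-residues =
    m , s≤s z≤n , ℕ.*-cancelʳ-< p m p mp<p² , four (+ i) (+ j) (+ 1) (+ 0) (begin
      + m * + p                           ≡⟨ pos-* m p ⟨
      + (m ℕ.* p)                         ≡⟨ cong +_ mp≡ ⟩
      + (i ℕ.* i ℕ.+ j ℕ.* j ℕ.+ 1)       ≡⟨ pos-+ (i ℕ.* i ℕ.+ j ℕ.* j) 1 ⟩
      + (i ℕ.* i ℕ.+ j ℕ.* j) + + 1       ≡⟨ cong (_+ + 1) (pos-+ (i ℕ.* i) (j ℕ.* j)) ⟩
      + (i ℕ.* i) + + (j ℕ.* j) + + 1     ≡⟨ cong₂ (λ u v → u + v + + 1) (pos-* i i) (pos-* j j) ⟩
      (+ i) ² + (+ j) ² + + 1                 ≡⟨ +0 ((+ i) ² + (+ j) ² + + 1) ⟩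
      (+ i) ² + (+ j) ² + + 1 + + 0           ∎)
    where
    open ≡-Reasoning
    i j m : ℕ
    i = toℕ i′
    j = toℕ j′
    -- The two remainders and the extra 1 add up to exactly p, which raises the sum of the quotients
    -- by one.
    m = suc (i ℕ.* i / p ℕ.+ j ℕ.* j / p)
    +0 : ∀ z → z ≡ z + + 0
    +0 = solve-∀
    remainders : i ℕ.* i % p ℕ.+ suc (j ℕ.* j % p) ≡ p
    remainders = trans (cong (ℕ._+ suc (j ℕ.* j % p))
      (trans (sym (toℕ-square-residue i)) (trans (cong toℕ eq)
        (trans (opposite-prop (square-residue j)) (cong (λ v → p ∸ suc v) (toℕ-square-residue j))))))
      (ℕ.m∸n+n≡m (m%n<n (j ℕ.* j) p))
    regroup : ∀ a b c d p → c ℕ.+ suc d ≡ p →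
      suc (a ℕ.+ b) ℕ.* p ≡ (c ℕ.+ a ℕ.* p) ℕ.+ (d ℕ.+ b ℕ.* p) ℕ.+ 1
    regroup a b c d _ refl = lemma a b c d
      where lemma : ∀ a b c d → suc (a ℕ.+ b) ℕ.* (c ℕ.+ suc d)
                    ≡ (c ℕ.+ a ℕ.* (c ℕ.+ suc d)) ℕ.+ (d ℕ.+ b ℕ.* (c ℕ.+ suc d)) ℕ.+ 1
            lemma = solve-ℕ
    mp≡ : m ℕ.* p ≡ i ℕ.* i ℕ.+ j ℕ.* j ℕ.+ 1
    mp≡ = trans (regroup (i ℕ.* i / p) (j ℕ.* j / p) (i ℕ.* i % p) (j ℕ.* j % p) p remainders)
      (cong₂ (λ u v → u ℕ.+ v ℕ.+ 1) (sym (m≡m%n+[m/n]*n (i ℕ.* i) p)) (sym (m≡m%n+[m/n]*n (j ℕ.* j) p)))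
    expand : ∀ h → suc (h ℕ.+ h) ℕ.* suc (h ℕ.+ h)
      ≡ (h ℕ.* h ℕ.+ h ℕ.* h ℕ.+ 1) ℕ.+ (2 ℕ.* h ℕ.* h ℕ.+ 3 ℕ.* h ℕ.+ h)
    expand = solve-ℕ
    mp<p² : m ℕ.* p < p ℕ.* p
    mp<p² = ℕ.≤-<-trans
      (ℕ.≤-trans (ℕ.≤-reflexive mp≡) (ℕ.+-monoˡ-≤ 1 (ℕ.+-mono-≤
        (ℕ.*-mono-≤ (toℕ≤pred[n] i′) (toℕ≤pred[n] i′)) (ℕ.*-mono-≤ (toℕ≤pred[n] j′) (toℕ≤pred[n] j′)))))
      (subst (h ℕ.* h ℕ.+ h ℕ.* h ℕ.+ 1 <_) (sym (expand h))
        (ℕ.m<m+n (h ℕ.* h ℕ.+ h ℕ.* h ℕ.+ 1) (ℕ.<-≤-trans 0<h (ℕ.m≤n+m h _))))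

  prime-four-squares : SumOfFourSquares (+ p)
  prime-four-squares with m , 0<m , m<p , s ← multiple-of-p = descent p-prime m (<-wellFounded m) 0<m m<p s

-- The class 3 modulo 4: odd entries and prime factors

-- For literal residues the side condition evaluates to the unit type, so the implicit argument
-- fills itself in.
mod4-unique : ∀ {n} x y → n ≈ x [mod + 4 ] → n ≈ y [mod + 4 ] → {False (4 ∣? ∣ x - y ∣)} → ⊥
mod4-unique {n} x y (k , eq) (l , eq′) {4∤} = toWitnessFalse 4∤ (divides ∣ l - k ∣ (begin
  ∣ x - y ∣                                  ≡⟨ cong ∣_∣ (expand k l x y) ⟩
  ∣ (+ 4 * k + x) - (+ 4 * l + y) + + 4 * (l - k) ∣ ≡⟨ cong₂ (λ u v → ∣ u - v + + 4 * (l - k) ∣) eq eq′ ⟨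
  ∣ n - n + + 4 * (l - k) ∣                  ≡⟨ cong ∣_∣ (collect n (l - k)) ⟩
  ∣ (l - k) * + 4 ∣                          ≡⟨ abs-* (l - k) (+ 4) ⟩
  ∣ l - k ∣ ℕ.* 4                            ∎))
  where
  open ≡-Reasoning
  expand : ∀ k l x y → x - y ≡ (+ 4 * k + x) - (+ 4 * l + y) + + 4 * (l - k)
  expand = solve-∀
  collect : ∀ n d → n - n + + 4 * d ≡ d * + 4
  collect = solve-∀

pos-mod4 : ∀ n → + n ≈ + (n % 4) [mod + 4 ]
pos-mod4 n = + (n / 4) , (begin
  + n                          ≡⟨ cong +_ (m≡m%n+[m/n]*n n 4) ⟩
  + (n % 4 ℕ.+ n / 4 ℕ.* 4)    ≡⟨ pos-+ (n % 4) (n / 4 ℕ.* 4) ⟩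
  + (n % 4) + + (n / 4 ℕ.* 4)  ≡⟨ cong (_+_ (+ (n % 4))) (pos-* (n / 4) 4) ⟩
  + (n % 4) + + (n / 4) * + 4  ≡⟨ lemma (+ (n % 4)) (+ (n / 4)) ⟩
  + 4 * + (n / 4) + + (n % 4)  ∎)
  where
  open ≡-Reasoning
  lemma : ∀ r q → r + q * + 4 ≡ + 4 * q + r
  lemma = solve-∀

≈3⇒%4≡3 : ∀ n → + n ≈ + 3 [mod + 4 ] → n % 4 ≡ 3
≈3⇒%4≡3 n c with n % 4 | pos-mod4 n | m%n<n n 4
... | 0 | c′ | _ = ⊥-elim (mod4-unique (+ 3) (+ 0) c c′)
... | 1 | c′ | _ = ⊥-elim (mod4-unique (+ 3) (+ 1) c c′)
... | 2 | c′ | _ = ⊥-elim (mod4-unique (+ 3) (+ 2) c c′)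
... | 3 | _  | _ = refl
... | suc (suc (suc (suc _))) | _ | s≤s (s≤s (s≤s (s≤s ())))

record ThreeOddSquares (n : ℤ) : Set where
  constructor three-odd
  field
    a b c d  : ℤ
    equality : n ≡ (+ 2 * a + + 1) ² + (+ 2 * b + + 1) ² + (+ 2 * c + + 1) ² + (+ 2 * d) ²

data TwoSquares (n : ℤ) : Set where
  both-even : n ≈ + 0 [mod + 4 ] → TwoSquares n
  mixed     : ∀ k l → n ≡ (+ 2 * k + + 1) ² + (+ 2 * l) ² → TwoSquares n
  both-odd  : ∀ k l → n ≡ (+ 2 * k + + 1) ² + (+ 2 * l + + 1) ² → TwoSquares n

twoSquares : ∀ a b → TwoSquares (a ² + b ²)
twoSquares a b with parity a | parity b
... | inj₁ ea         | inj₁ eb         = both-even (+-cong-mod (even-square-mod4 ea) (even-square-mod4 eb))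
... | inj₂ (k , refl) | inj₁ (l , refl) = mixed k l refl
... | inj₁ (k , refl) | inj₂ (l , refl) = mixed l k (+-comm ((+ 2 * k) ²) _)
... | inj₂ (k , refl) | inj₂ (l , refl) = both-odd k l refl

oddEntries : ∀ {n} → TwoSquares n → ℤ
oddEntries (both-even _)    = + 0
oddEntries (mixed _ _ _)    = + 1
oddEntries (both-odd _ _ _) = + 2

≈oddEntries : ∀ {n} (t : TwoSquares n) → n ≈ oddEntries t [mod + 4 ]
≈oddEntries (both-even n≈0)     = n≈0
≈oddEntries (mixed k l refl)    = +-cong-mod (odd-square-mod4 (k , refl)) (even-square-mod4 (l , refl))
≈oddEntries (both-odd k l refl) = +-cong-mod (odd-square-mod4 (k , refl)) (odd-square-mod4 (l , refl))

-- Squares are 0 or 1 modulo 4 by parity, so the residue counts the odd entries. Among the counts 0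
-- to 4 only 3 is congruent to 3, and over two pairs it arises only as 2 + 1.
not-three : ∀ {m n} → m + n ≈ + 3 [mod + 4 ] → (s : TwoSquares m) (t : TwoSquares n) →
  {False (4 ∣? ∣ + 3 - (oddEntries s + oddEntries t) ∣)} → ⊥
not-three c s t {4∤} =
  mod4-unique (+ 3) (oddEntries s + oddEntries t) c (+-cong-mod (≈oddEntries s) (≈oddEntries t)) {4∤}

three-odd-squares : ∀ {m n} → m + n ≈ + 3 [mod + 4 ] → TwoSquares m → TwoSquares n →
  ThreeOddSquares (m + n)
three-odd-squares _ (both-odd k l refl) (mixed i j refl) =
  three-odd k l i j (sym (+-assoc ((+ 2 * k + + 1) ² + (+ 2 * l + + 1) ²) _ _))
three-odd-squares _ (mixed i j refl) (both-odd k l refl) =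
  three-odd k l i j (trans (+-comm ((+ 2 * i + + 1) ² + (+ 2 * j) ²) _)
                           (sym (+-assoc ((+ 2 * k + + 1) ² + (+ 2 * l + + 1) ²) _ _)))
three-odd-squares c s@(both-even _) t@(both-even _) = ⊥-elim (not-three c s t)
three-odd-squares c s@(both-even _) t@(mixed _ _ _) = ⊥-elim (not-three c s t)
three-odd-squares c s@(both-even _) t@(both-odd _ _ _) = ⊥-elim (not-three c s t)
three-odd-squares c s@(mixed _ _ _) t@(both-even _) = ⊥-elim (not-three c s t)
three-odd-squares c s@(mixed _ _ _) t@(mixed _ _ _) = ⊥-elim (not-three c s t)
three-odd-squares c s@(both-odd _ _ _) t@(both-even _) = ⊥-elim (not-three c s t)
three-odd-squares c s@(both-odd _ _ _) t@(both-odd _ _ _) = ⊥-elim (not-three c s t)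

%4-factors : ∀ x y → x < 4 → y < 4 → x ℕ.* y % 4 ≡ 3 → (x ≡ 3 × y ≡ 1) ⊎ (x ≡ 1 × y ≡ 3)
%4-factors 3 1 _ _ _ = inj₁ (refl , refl)
%4-factors 1 3 _ _ _ = inj₂ (refl , refl)
%4-factors 0 _ _ _ ()
%4-factors 1 0 _ _ ()
%4-factors 1 1 _ _ ()
%4-factors 1 2 _ _ ()
%4-factors 2 0 _ _ ()
%4-factors 2 1 _ _ ()
%4-factors 2 2 _ _ ()
%4-factors 2 3 _ _ ()
%4-factors 3 0 _ _ ()
%4-factors 3 2 _ _ ()
%4-factors 3 3 _ _ ()
%4-factors (suc (suc (suc (suc _)))) _ (s≤s (s≤s (s≤s (s≤s ())))) _ _
%4-factors _ (suc (suc (suc (suc _)))) _ (s≤s (s≤s (s≤s (s≤s ())))) _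

product%4≡3 : ∀ m n → m ℕ.* n % 4 ≡ 3 → (m % 4 ≡ 3 × n % 4 ≡ 1) ⊎ (m % 4 ≡ 1 × n % 4 ≡ 3)
product%4≡3 m n eq = %4-factors (m % 4) (n % 4) (m%n<n m 4) (m%n<n n 4) (trans (sym (%-distribˡ-* m n 4)) eq)

record PrimeFactor3mod4 (n : ℕ) : Set where
  constructor prime-factor
  field
    p cofactor     : ℕ
    isPrime        : Prime p
    p%4≡3          : p % 4 ≡ 3
    factorisation  : n ≡ p ℕ.* cofactor
    cofactor%4≡1   : cofactor % 4 ≡ 1

-- A product is 3 modulo 4 only if one factor is 3 and the other 1, so the search follows the factor
-- that is 3. The empty product is 1, which stops it from running off the list.
primeFactor-list : ∀ ps → All Prime ps → product ps % 4 ≡ 3 → PrimeFactor3mod4 (product ps)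
primeFactor-list (p ∷ ps) (p-prime ∷ primes) eq with product%4≡3 p (product ps) eq
... | inj₁ (p≡3 , ps≡1) = prime-factor p (product ps) p-prime p≡3 refl ps≡1
... | inj₂ (p≡1 , ps≡3) with primeFactor-list ps primes ps≡3
... | prime-factor q r q-prime q≡3 ps≡ r≡1 = prime-factor q (p ℕ.* r) q-prime q≡3
  (trans (cong (p ℕ.*_) ps≡) (lemma p q r))
  (trans (%-distribˡ-* p r 4) (cong₂ (λ x y → x ℕ.* y % 4) p≡1 r≡1))
  where lemma : ∀ p q r → p ℕ.* (q ℕ.* r) ≡ q ℕ.* (p ℕ.* r)
        lemma = solve-ℕ

primeFactor : ∀ n → n % 4 ≡ 3 → PrimeFactor3mod4 n
primeFactor n@(suc _) n%4≡3 = subst PrimeFactor3mod4 (sym n≡)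
  (primeFactor-list fs primes (subst (λ k → k % 4 ≡ 3) n≡ n%4≡3))
  where open PrimeFactorisation (factorise n)
          renaming (factors to fs; isFactorisation to n≡; factorsPrime to primes)

-- The sign matters: -1 is also 3 modulo 4 but has no prime factor. The class of N speaks about the
-- factorisation of its absolute value only once N is known to be a natural number.
norm₄-nonneg : ∀ p q a b y₀ y₁ y₂ y₃ → ∃ λ n → norm₄ p q a b y₀ y₁ y₂ y₃ ≡ + n
norm₄-nonneg p q a b y₀ y₁ y₂ y₃ = _ , sum
  (sum (square (p - a - + 2 * y₀)) (square (a - + 2 * y₂))) (sum (square (q - b - + 2 * y₁)) (square (b - + 2 * y₃)))
  where
  square : ∀ x → x ² ≡ + (∣ x ∣ ℕ.* ∣ x ∣)
  square x = sym (square-abs x)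
  sum : ∀ {x y m n} → x ≡ + m → y ≡ + n → x + y ≡ + (m ℕ.+ n)
  sum {m = m} {n} refl refl = sym (pos-+ m n)

-- With n = p r and r odd, L n² = (L r²) p², and r² is 1 modulo 8, so L r² stays in the class of -3.
exceptional-form : ∀ {L n} → L ≈ - + 3 [mod + 8 ] → + n ≈ + 3 [mod + 4 ] →
  ∃ λ (m : ℤ) → Σ ℕ λ p → Prime p × p % 4 ≡ 3 × L * (+ n * + n) ≡ (+ 8 * m - + 3) * (+ p * + p)
exceptional-form {L} {n} L≈ n≈ with primeFactor n (≈3⇒%4≡3 n n≈)
... | prime-factor p r p-prime p≡3 n≡ r≡1 =
  let r-odd = ≈1⇒Odd (subst (λ v → + r ≈ + v [mod + 4 ]) r≡1 (pos-mod4 r))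
      m , eq = *-cong-mod L≈ (odd-square r-odd)
  in m , p , p-prime , p≡3 , (begin
    L * (+ n * + n)                     ≡⟨ cong (λ v → L * (v * v)) (trans (cong +_ n≡) (pos-* p r)) ⟩
    L * (+ p * + r * (+ p * + r))       ≡⟨ lemma L (+ p) (+ r) ⟩
    L * (+ r * + r) * (+ p * + p)       ≡⟨ cong (_* (+ p * + p)) eq ⟩
    (+ 8 * m - + 3) * (+ p * + p)       ∎)
  where
  open ≡-Reasoning
  lemma : ∀ L p r → L * (p * r * (p * r)) ≡ L * (r * r) * (p * p)
  lemma = solve-∀

four⇒three-odd-squares : ∀ {n} → n ≈ + 3 [mod + 4 ] → SumOfFourSquares n → ThreeOddSquares n
four⇒three-odd-squares {n} n≈3 (four a b c d eq) = subst ThreeOddSquares (sym n≡)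
  (three-odd-squares (subst (λ v → v ≈ + 3 [mod + 4 ]) n≡ n≈3) (twoSquares a b) (twoSquares c d))
  where
  n≡ : n ≡ a ² + b ² + (c ² + d ²)
  n≡ = trans eq (+-assoc (a ² + b ²) (c ²) (d ²))

prime-sum-of-four-squares : ∀ {p} → Prime p → p % 4 ≡ 3 → SumOfFourSquares (+ p)
prime-sum-of-four-squares {p} p-prime p≡3 = transport p≡ p-prime
  where
  h : ℕ
  h = suc (2 ℕ.* (p / 4))
  -- `h` is computed from `p`, so the equation for `p` cannot be matched with `refl`; a fresh `q`
  -- can be replaced.
  transport : ∀ {q} → q ≡ suc (h ℕ.+ h) → Prime q → SumOfFourSquares (+ q)
  transport refl = prime-four-squares h (s≤s z≤n)
  lemma : ∀ q → 3 ℕ.+ q ℕ.* 4 ≡ suc (suc (2 ℕ.* q) ℕ.+ suc (2 ℕ.* q))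
  lemma = solve-ℕ
  p≡ : p ≡ suc (h ℕ.+ h)
  p≡ = trans (m≡m%n+[m/n]*n p 4) (trans (cong (ℕ._+ p / 4 ℕ.* 4) p≡3) (lemma (p / 4)))

prime-three-odd-squares : ∀ {p} → Prime p → p % 4 ≡ 3 → ThreeOddSquares (+ p)
prime-three-odd-squares {p} p-prime p≡3 = four⇒three-odd-squares
  (subst (λ v → + p ≈ + v [mod + 4 ]) p≡3 (pos-mod4 p)) (prime-sum-of-four-squares p-prime p≡3)

-- The three value sets

-- The number of variables is left open so that one expression serves twice: at eight variables
-- against the determinant, and at the single parameter of each family of values.
det-Z4×Z2 det-Q8 det-Z2³ : ∀ {n} → (x₀ x₁ x₂ x₃ x₄ x₅ x₆ x₇ : Expr n) → Expr n
det-Z4×Z2 x₀ x₁ x₂ x₃ x₄ x₅ x₆ x₇ =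
  let p = x₀ :+ x₄ :+ (x₂ :+ x₆) ; q = x₁ :+ x₅ :+ (x₃ :+ x₇) ; a = x₂ :+ x₆ ; b = x₃ :+ x₇
  in :Δ₄ p q a b :*
     :Δ₄ (p :- con (+ 2) :* (x₄ :+ x₆)) (q :- con (+ 2) :* (x₅ :+ x₇)) (a :- con (+ 2) :* x₆) (b :- con (+ 2) :* x₇)
det-Q8 x₀ x₁ x₂ x₃ x₄ x₅ x₆ x₇ =
  let p = x₀ :+ x₂ :+ (x₄ :+ x₆) ; q = x₁ :+ x₃ :+ (x₅ :+ x₇) ; a = x₄ :+ x₆ ; b = x₅ :+ x₇
      N = :norm₄ p q a b x₂ x₃ x₆ x₇
  in :Δ₂₂ p q a b :* (N :* N)
det-Z2³ x₀ x₁ x₂ x₃ x₄ x₅ x₆ x₇ =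
  let p = x₀ :+ x₄ :+ (x₂ :+ x₆) ; q = x₁ :+ x₅ :+ (x₃ :+ x₇) ; a = x₂ :+ x₆ ; b = x₃ :+ x₇
  in :Δ₂₂ p q a b :*
     :Δ₂₂ (p :- con (+ 2) :* (x₄ :+ x₆)) (q :- con (+ 2) :* (x₅ :+ x₇)) (a :- con (+ 2) :* x₆) (b :- con (+ 2) :* x₇)

generic : (∀ {n} → (x₀ x₁ x₂ x₃ x₄ x₅ x₆ x₇ : Expr n) → Expr n) → Expr 8
generic e = e (var (# 0)) (var (# 1)) (var (# 2)) (var (# 3)) (var (# 4)) (var (# 5)) (var (# 6)) (var (# 7))

hasDet-Z4×Z2 : HasDet Z4×Z2 (generic det-Z4×Z2)
hasDet-Z4×Z2 = has-det refl

hasDet-Q8 : HasDet Q8 (generic det-Q8)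
hasDet-Q8 = has-det refl

hasDet-Z2³ : HasDet Z2³ (generic det-Z2³)
hasDet-Z2³ = has-det refl

Values-Z4×Z2 Values-exceptional Values-Z2³ : ℤ → Set
Values-Z4×Z2 z = (∃ λ (m : ℤ) → z ≡ + 8 * m + + 1) ⊎ (∃ λ (m : ℤ) → z ≡ + 256 * m)
Values-exceptional z =
  ∃ λ (m : ℤ) → Σ ℕ λ p → Prime p × p % 4 ≡ 3 × z ≡ (+ 8 * m - + 3) * (+ p * + p)
Values-Z2³ z = (∃ λ (m : ℤ) → z ≡ + 8 * m + + 1)
  ⊎ (∃ λ (m : ℤ) → z ≡ + 256 * (+ 4 * m + + 1))
  ⊎ (∃ λ (m : ℤ) → z ≡ + 4096 * m)

≈⇒∃ : ∀ {x y n} → x ≈ y [mod n ] → ∃ λ m → x ≡ n * m + y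
≈⇒∃ (m , eq) = m , eq

classify : ∀ p q a b y₀ y₁ y₂ y₃ →
  let N = norm₄ p q a b y₀ y₁ y₂ y₃ ; z = Δ₂₂ p q a b * (N * N) in
  Values-Z4×Z2 z ⊎ Values-exceptional z
classify p q a b y₀ y₁ y₂ y₃ = [ (λ c → inj₁ (inj₂ c)) , [ (λ c → inj₁ (inj₁ (≈⇒∃ c))) , exceptional ]′ ]′
  (Q8-residues p q a b y₀ y₁ y₂ y₃)
  where
  N z : ℤ
  N = norm₄ p q a b y₀ y₁ y₂ y₃
  z = Δ₂₂ p q a b * (N * N)
  exceptional : Δ₂₂ p q a b ≈ - + 3 [mod + 8 ] × N ≈ + 3 [mod + 4 ] → Values-Z4×Z2 z ⊎ Values-exceptional z
  exceptional (L≈ , N≈) =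
    let n , N≡n = norm₄-nonneg p q a b y₀ y₁ y₂ y₃
    in inj₂ (subst (λ v → Values-exceptional (Δ₂₂ p q a b * (v * v))) (sym N≡n)
         (exceptional-form L≈ (subst (λ v → v ≈ + 3 [mod + 4 ]) N≡n N≈)))

Z4×Z2-values : ∀ ρ → Values-Z4×Z2 (⟦ generic det-Z4×Z2 ⟧ ρ)
Z4×Z2-values (x₀ ∷ x₁ ∷ x₂ ∷ x₃ ∷ x₄ ∷ x₅ ∷ x₆ ∷ x₇ ∷ []) = map₁ ≈⇒∃
  (Z4×Z2-residues (x₀ + x₄ + (x₂ + x₆)) (x₁ + x₅ + (x₃ + x₇)) (x₂ + x₆) (x₃ + x₇) (x₄ + x₆) (x₅ + x₇) x₆ x₇)

Z2³-values : ∀ ρ → Values-Z2³ (⟦ generic det-Z2³ ⟧ ρ)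
Z2³-values (x₀ ∷ x₁ ∷ x₂ ∷ x₃ ∷ x₄ ∷ x₅ ∷ x₆ ∷ x₇ ∷ []) = map₁ ≈⇒∃
  (Z2³-residues (x₀ + x₄ + (x₂ + x₆)) (x₁ + x₅ + (x₃ + x₇)) (x₂ + x₆) (x₃ + x₇) (x₄ + x₆) (x₅ + x₇) x₆ x₇)

Q8-values : ∀ ρ → Values-Z4×Z2 (⟦ generic det-Q8 ⟧ ρ) ⊎ Values-exceptional (⟦ generic det-Q8 ⟧ ρ)
Q8-values (x₀ ∷ x₁ ∷ x₂ ∷ x₃ ∷ x₄ ∷ x₅ ∷ x₆ ∷ x₇ ∷ []) =
  classify (x₀ + x₂ + (x₄ + x₆)) (x₁ + x₃ + (x₅ + x₇)) (x₄ + x₆) (x₅ + x₇) x₂ x₃ x₆ x₇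

𝒮-Z4×Z2⇒ : ∀ {z} → 𝒮 Z4×Z2 z → Values-Z4×Z2 z
𝒮-Z4×Z2⇒ = 𝒮-elim Z4×Z2 hasDet-Z4×Z2 Values-Z4×Z2 Z4×Z2-values

𝒮-Z2³⇒ : ∀ {z} → 𝒮 Z2³ z → Values-Z2³ z
𝒮-Z2³⇒ = 𝒮-elim Z2³ hasDet-Z2³ Values-Z2³ Z2³-values

𝒮-Q8⇒ : ∀ {z} → 𝒮 Q8 z → Values-Z4×Z2 z ⊎ Values-exceptional z
𝒮-Q8⇒ = 𝒮-elim Q8 hasDet-Q8 (λ z → Values-Z4×Z2 z ⊎ Values-exceptional z) Q8-values

-- Adding m to every variable adds 8m to the factor of the trivial character and fixes the others;
-- in each family the other factors multiply to the right power of 2.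
Z4×Z2-8m+1 : ∀ m → 𝒮 Z4×Z2 (+ 8 * m + + 1)
Z4×Z2-8m+1 m = 𝒮-intro Z4×Z2 hasDet-Z4×Z2
  (m + + 1 ∷ m ∷ m ∷ m ∷ m ∷ m ∷ m ∷ m ∷ [])
  (solve 1 (λ m → det-Z4×Z2 (m :+ con (+ 1)) m m m m m m m
    := con (+ 8) :* m :+ con (+ 1)) refl m)

Z4×Z2-512m : ∀ m → 𝒮 Z4×Z2 (+ 256 * (+ 2 * m))
Z4×Z2-512m m = 𝒮-intro Z4×Z2 hasDet-Z4×Z2
  (m + - + 1 ∷ m + - + 1 ∷ m ∷ m ∷ m ∷ m + + 1 ∷ m ∷ m + + 1 ∷ [])
  (solve 1 (λ m → det-Z4×Z2 (m :+ con (- + 1)) (m :+ con (- + 1)) m m m (m :+ con (+ 1)) m (m :+ con (+ 1))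
    := con (+ 256) :* (con (+ 2) :* m)) refl m)

-- The constants add up to 4, so the trivial character gives 8m + 4 and the other factors multiply
-- to 64. In the companion family the constants add up to 0, giving 8m · 64; together the two cover
-- both parities of the multiplier of 256.
Z4×Z2-512m+256 : ∀ m → 𝒮 Z4×Z2 (+ 256 * (+ 2 * m + + 1))
Z4×Z2-512m+256 m = 𝒮-intro Z4×Z2 hasDet-Z4×Z2
  (m ∷ m ∷ m ∷ m ∷ m ∷ m + + 1 ∷ m + + 1 ∷ m + + 2 ∷ [])
  (solve 1 (λ m → det-Z4×Z2 m m m m m (m :+ con (+ 1)) (m :+ con (+ 1)) (m :+ con (+ 2))
    := con (+ 256) :* (con (+ 2) :* m :+ con (+ 1))) refl m)

Q8-8m+1 : ∀ m → 𝒮 Q8 (+ 8 * m + + 1)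
Q8-8m+1 m = 𝒮-intro Q8 hasDet-Q8
  (m + + 1 ∷ m ∷ m ∷ m ∷ m ∷ m ∷ m ∷ m ∷ [])
  (solve 1 (λ m → det-Q8 (m :+ con (+ 1)) m m m m m m m
    := con (+ 8) :* m :+ con (+ 1)) refl m)

Q8-512m : ∀ m → 𝒮 Q8 (+ 256 * (+ 2 * m))
Q8-512m m = 𝒮-intro Q8 hasDet-Q8
  (m + - + 1 ∷ m + - + 1 ∷ m ∷ m ∷ m ∷ m + + 1 ∷ m ∷ m + + 1 ∷ [])
  (solve 1 (λ m → det-Q8 (m :+ con (- + 1)) (m :+ con (- + 1)) m m m (m :+ con (+ 1)) m (m :+ con (+ 1))
    := con (+ 256) :* (con (+ 2) :* m)) refl m)

Q8-512m+256 : ∀ m → 𝒮 Q8 (+ 256 * (+ 2 * m + + 1))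
Q8-512m+256 m = 𝒮-intro Q8 hasDet-Q8
  (m ∷ m ∷ m ∷ m ∷ m ∷ m + + 1 ∷ m + + 1 ∷ m + + 2 ∷ [])
  (solve 1 (λ m → det-Q8 m m m m m (m :+ con (+ 1)) (m :+ con (+ 1)) (m :+ con (+ 2))
    := con (+ 256) :* (con (+ 2) :* m :+ con (+ 1))) refl m)

Z2³-8m+1 : ∀ m → 𝒮 Z2³ (+ 8 * m + + 1)
Z2³-8m+1 m = 𝒮-intro Z2³ hasDet-Z2³
  (m + + 1 ∷ m ∷ m ∷ m ∷ m ∷ m ∷ m ∷ m ∷ [])
  (solve 1 (λ m → det-Z2³ (m :+ con (+ 1)) m m m m m m m
    := con (+ 8) :* m :+ con (+ 1)) refl m)

Z2³-1024m+256 : ∀ m → 𝒮 Z2³ (+ 256 * (+ 4 * m + + 1))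
Z2³-1024m+256 m = 𝒮-intro Z2³ hasDet-Z2³
  (m + + 2 ∷ m ∷ m ∷ m ∷ m ∷ m ∷ m ∷ m ∷ [])
  (solve 1 (λ m → det-Z2³ (m :+ con (+ 2)) m m m m m m m
    := con (+ 256) :* (con (+ 4) :* m :+ con (+ 1))) refl m)

Z2³-8192m : ∀ k → 𝒮 Z2³ (+ 4096 * (+ 2 * k))
Z2³-8192m k = 𝒮-intro Z2³ hasDet-Z2³
  -- The constants add up to 0 and the nontrivial factors multiply to -1024; the shift by -k
  -- compensates for that sign.
  (- + 1 - k ∷ - + 1 - k ∷ - + 1 - k ∷ + 2 - k ∷ + 0 - k ∷ + 0 - k ∷ + 0 - k ∷ + 1 - k ∷ [])
  (solve 1 (λ k → det-Z2³ (con (- + 1) :- k) (con (- + 1) :- k) (con (- + 1) :- k) (con (+ 2) :- k)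
                          (con (+ 0) :- k) (con (+ 0) :- k) (con (+ 0) :- k) (con (+ 1) :- k)
    := con (+ 4096) :* (con (+ 2) :* k)) refl k)

Z2³-8192m+4096 : ∀ m → 𝒮 Z2³ (+ 4096 * (+ 2 * m + + 1))
Z2³-8192m+4096 m = 𝒮-intro Z2³ hasDet-Z2³
  (m + - + 1 ∷ m ∷ m ∷ m + + 1 ∷ m ∷ m + + 2 ∷ m + + 2 ∷ m ∷ [])
  (solve 1 (λ m → det-Z2³ (m :+ con (- + 1)) m m (m :+ con (+ 1)) m (m :+ con (+ 2)) (m :+ con (+ 2)) m
    := con (+ 4096) :* (con (+ 2) :* m :+ con (+ 1))) refl m)

-- L and N can then be evaluated separately, without normalising the whole product of degree eight.
Q8-value : ∀ x₀ x₁ x₂ x₃ x₄ x₅ x₆ x₇ {L N} →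
  Δ₂₂ (x₀ + x₂ + (x₄ + x₆)) (x₁ + x₃ + (x₅ + x₇)) (x₄ + x₆) (x₅ + x₇) ≡ L →
  norm₄ (x₀ + x₂ + (x₄ + x₆)) (x₁ + x₃ + (x₅ + x₇)) (x₄ + x₆) (x₅ + x₇) x₂ x₃ x₆ x₇ ≡ N →
  𝒮 Q8 (L * (N * N))
Q8-value x₀ x₁ x₂ x₃ x₄ x₅ x₆ x₇ L≡ N≡ =
  𝒮-intro Q8 hasDet-Q8 (x₀ ∷ x₁ ∷ x₂ ∷ x₃ ∷ x₄ ∷ x₅ ∷ x₆ ∷ x₇ ∷ [])
    (cong₂ (λ L N → L * (N * N)) L≡ N≡)

-- Each pair x(g), x(a²g) is solved from a prescribed sum and difference of equal parity. The
-- differences are the four entries of the decomposition. The sums are 1 - 2m three times and -2m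
-- once, where the ℤ₂ × ℤ₂ determinant is (3 - 8m) · 1 · 1 · (-1).
Q8-exceptional : ∀ m {n} → ThreeOddSquares n → 𝒮 Q8 ((+ 8 * m - + 3) * (n * n))
Q8-exceptional m (three-odd w₀ w₁ w₂ w₃ refl) = Q8-value
  (w₀ - m + + 1) (w₁ - m + + 1) (+ 0 - m - w₀) (+ 0 - m - w₁)
  (w₂ - m + + 1) (w₃ - m) (+ 0 - m - w₂) (+ 0 - m - w₃)
  (Δ₂₂≡ m w₀ w₁ w₂ w₃) (norm₄≡ m w₀ w₁ w₂ w₃)
  where
  Δ₂₂≡ : ∀ m w₀ w₁ w₂ w₃ →
    Δ₂₂ (w₀ - m + + 1 + (+ 0 - m - w₀) + (w₂ - m + + 1 + (+ 0 - m - w₂)))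
        (w₁ - m + + 1 + (+ 0 - m - w₁) + (w₃ - m + (+ 0 - m - w₃)))
        (w₂ - m + + 1 + (+ 0 - m - w₂)) (w₃ - m + (+ 0 - m - w₃))
    ≡ + 8 * m - + 3
  Δ₂₂≡ = solve 5 (λ m w₀ w₁ w₂ w₃ →
    :Δ₂₂ (w₀ :- m :+ con (+ 1) :+ (con (+ 0) :- m :- w₀) :+ (w₂ :- m :+ con (+ 1) :+ (con (+ 0) :- m :- w₂)))
         (w₁ :- m :+ con (+ 1) :+ (con (+ 0) :- m :- w₁) :+ (w₃ :- m :+ (con (+ 0) :- m :- w₃)))
         (w₂ :- m :+ con (+ 1) :+ (con (+ 0) :- m :- w₂)) (w₃ :- m :+ (con (+ 0) :- m :- w₃))
    := con (+ 8) :* m :- con (+ 3)) refl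
  norm₄≡ : ∀ m w₀ w₁ w₂ w₃ →
    norm₄ (w₀ - m + + 1 + (+ 0 - m - w₀) + (w₂ - m + + 1 + (+ 0 - m - w₂)))
          (w₁ - m + + 1 + (+ 0 - m - w₁) + (w₃ - m + (+ 0 - m - w₃)))
          (w₂ - m + + 1 + (+ 0 - m - w₂)) (w₃ - m + (+ 0 - m - w₃))
          (+ 0 - m - w₀) (+ 0 - m - w₁) (+ 0 - m - w₂) (+ 0 - m - w₃)
    ≡ (+ 2 * w₀ + + 1) ² + (+ 2 * w₁ + + 1) ² + (+ 2 * w₂ + + 1) ² + (+ 2 * w₃) ²
  norm₄≡ = solve 5 (λ m w₀ w₁ w₂ w₃ →
    :norm₄ (w₀ :- m :+ con (+ 1) :+ (con (+ 0) :- m :- w₀) :+ (w₂ :- m :+ con (+ 1) :+ (con (+ 0) :- m :- w₂)))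
           (w₁ :- m :+ con (+ 1) :+ (con (+ 0) :- m :- w₁) :+ (w₃ :- m :+ (con (+ 0) :- m :- w₃)))
           (w₂ :- m :+ con (+ 1) :+ (con (+ 0) :- m :- w₂)) (w₃ :- m :+ (con (+ 0) :- m :- w₃))
           (con (+ 0) :- m :- w₀) (con (+ 0) :- m :- w₁) (con (+ 0) :- m :- w₂) (con (+ 0) :- m :- w₃)
    := (con (+ 2) :* w₀ :+ con (+ 1)) ²ᵉ :+ (con (+ 2) :* w₁ :+ con (+ 1)) ²ᵉ
       :+ (con (+ 2) :* w₂ :+ con (+ 1)) ²ᵉ :+ (con (+ 2) :* w₃) ²ᵉ) refl

parity-elim : (P : ℤ → Set) → (∀ k → P (+ 2 * k)) → (∀ k → P (+ 2 * k + + 1)) → ∀ n → P n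
parity-elim P evens odds n with parity n
... | inj₁ (k , refl) = evens k
... | inj₂ (k , refl) = odds k

𝒮-Z4×Z2⇐ : ∀ {z} → Values-Z4×Z2 z → 𝒮 Z4×Z2 z
𝒮-Z4×Z2⇐ (inj₁ (m , refl)) = Z4×Z2-8m+1 m
𝒮-Z4×Z2⇐ (inj₂ (m , refl)) =
  parity-elim (λ m → 𝒮 Z4×Z2 (+ 256 * m)) Z4×Z2-512m Z4×Z2-512m+256 m

𝒮-Q8⇐ : ∀ {z} → Values-Z4×Z2 z ⊎ Values-exceptional z → 𝒮 Q8 z
𝒮-Q8⇐ (inj₁ (inj₁ (m , refl))) = Q8-8m+1 m
𝒮-Q8⇐ (inj₁ (inj₂ (m , refl))) = parity-elim (λ m → 𝒮 Q8 (+ 256 * m)) Q8-512m Q8-512m+256 m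
𝒮-Q8⇐ (inj₂ (m , p , p-prime , p≡3 , refl)) = Q8-exceptional m (prime-three-odd-squares p-prime p≡3)

𝒮-Z2³⇐ : ∀ {z} → Values-Z2³ z → 𝒮 Z2³ z
𝒮-Z2³⇐ (inj₁ (m , refl))        = Z2³-8m+1 m
𝒮-Z2³⇐ (inj₂ (inj₁ (m , refl))) = Z2³-1024m+256 m
𝒮-Z2³⇐ (inj₂ (inj₂ (m , refl))) =
  parity-elim (λ m → 𝒮 Z2³ (+ 4096 * m)) Z2³-8192m Z2³-8192m+4096 m

theorem3p1 : (∀ (z : ℤ) → 𝒮 Z4×Z2 z ⇔
    ((∃ λ (m : ℤ) → z ≡ + 8 * m + + 1) ⊎ (∃ λ (m : ℤ) → z ≡ + 256 * m)))
    × (∀ (z : ℤ) → 𝒮 Q8 z ⇔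
    (𝒮 Z4×Z2 z ⊎
    (∃ λ (m : ℤ) → Σ ℕ λ p → Prime p × p % 4 ≡ 3 × z ≡ (+ 8 * m - + 3) * (+ p * + p))))
    × (∀ (z : ℤ) → 𝒮 Z2³ z ⇔
    ((∃ λ (m : ℤ) → z ≡ + 8 * m + + 1)
    ⊎ (∃ λ (m : ℤ) → z ≡ + 256 * (+ 4 * m + + 1))
    ⊎ (∃ λ (m : ℤ) → z ≡ + 4096 * m)))
theorem3p1 =
    (λ z → mk⇔ (𝒮-Z4×Z2⇒ {z}) (𝒮-Z4×Z2⇐ {z}))
  , (λ z → mk⇔ (λ s → map₁ (𝒮-Z4×Z2⇐ {z}) (𝒮-Q8⇒ {z} s)) (λ s → 𝒮-Q8⇐ {z} (map₁ (𝒮-Z4×Z2⇒ {z}) s)))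
  , (λ z → mk⇔ (𝒮-Z2³⇒ {z}) (𝒮-Z2³⇐ {z}))
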